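{- Let $p,q$ be positive integers with $q\ge 4p+1$, and let $\mathrm{K}_{p,q}$ be the complete bipartite graph with parts of sizes $p$ and $q$. Then $\delta(\mathcal{A}(\mathrm{K}_{p,q}))=2pq$.
   Context: For a connected graph $G=(V,E)$, a search tree on $G$ is a rooted tree with vertex set $V$ defined recursively: its root is some vertex $r\in V$, and $r$ is joined to the roots of search trees on each connected component of $G-r$. The tubes of a search tree are the vertex sets of its subtrees. Two search trees on $G$ are related by a rotation if their sets of tubes have symmetric difference of size exactly two. The graph associahedron $\mathcal{A}(G)$ is a polytope whose skeleton is isomorphic to the graph on search trees of $G$ with adjacency given by rotations; $\delta(\mathcal{A}(G))$ is the diameter of this graph. -}

module Defs where

open import Data.Nat using (ℕ; zero; suc; _+_; _*_; _≤_; _<_)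
open import Data.Fin using (Fin; toℕ)
open import Data.Fin.Subset using (Subset; _∈_; _∉_; _⊆_; ⁅_⁆; _∪_; ⊥; ⊤; _-_; Nonempty)
open import Data.List using (List; []; _∷_)
open import Data.List.Relation.Unary.All using (All)
open import Data.List.Relation.Unary.Any using (Any)
open import Data.List.Relation.Unary.AllPairs using (AllPairs)
open import Data.List.Membership.Propositional using () renaming (_∈_ to _∈ₗ_)
open import Data.Product using (Σ; ∃; _×_; _,_)
open import Data.Sum using (_⊎_)
open import Relation.Nullary using (¬_)
open import Relation.Binary.PropositionalEquality using (_≡_; _≢_)
open import Function.Bundles using (_⇔_)

Graph : ℕ → Set₁
Graph n = Fin n → Fin n → Set

K : (p q : ℕ) → Graph (p + q)
K p q u v = (toℕ u < p × p ≤ toℕ v) ⊎ (p ≤ toℕ u × toℕ v < p)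

-- Rooted trees whose nodes are labelled by vertices (children unordered in
-- meaning; the order of the list is irrelevant since trees are compared
-- through their tube sets).
data Tree (n : ℕ) : Set where
  node : Fin n → List (Tree n) → Tree n

mutual
  vset : ∀ {n} → Tree n → Subset n
  vset (node r ts) = ⁅ r ⁆ ∪ vsets ts

  vsets : ∀ {n} → List (Tree n) → Subset n
  vsets []       = ⊥
  vsets (t ∷ ts) = vset t ∪ vsets ts

module _ {n : ℕ} (G : Graph n) where

  data Reach (C : Subset n) : Fin n → Fin n → Set where
    here : ∀ {u} → u ∈ C → Reach C u u
    step : ∀ {u v w} → u ∈ C → G u v → Reach C v w → Reach C u w

  Connected : Subset n → Set
  Connected C = ∀ {u v} → u ∈ C → v ∈ C → Reach C u v

  IsComponent : Subset n → Subset n → Set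
  IsComponent T C =
    C ⊆ T × Nonempty C × Connected C ×
    (∀ {u v} → u ∈ C → v ∈ T → G u v → v ∈ C)

  data IsSearchTree (S : Subset n) : Tree n → Set where
    node : ∀ {r ts} →
      r ∈ S →
      All (λ c → IsComponent (S - r) (vset c) × IsSearchTree (vset c) c) ts →
      (∀ C → IsComponent (S - r) C → Any (λ c → vset c ≡ C) ts) →
      AllPairs (λ a b → vset a ≢ vset b) ts →
      IsSearchTree S (node r ts)

  SearchTree : Tree n → Set
  SearchTree = IsSearchTree ⊤

data Tube {n : ℕ} : Tree n → Subset n → Set where
  root : ∀ {t} → Tube t (vset t)
  sub  : ∀ {r ts c X} → c ∈ₗ ts → Tube c X → Tube (node r ts) X

-- same set of tubes (i.e. the same search tree)
SameTubes : ∀ {n} → Tree n → Tree n → Set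
SameTubes t u = ∀ X → Tube t X ⇔ Tube u X

Rotation : ∀ {n} → Tree n → Tree n → Set
Rotation t u = Σ _ λ A → Σ _ λ B → A ≢ B ×
  (∀ X → ((Tube t X × ¬ Tube u X) ⊎ (Tube u X × ¬ Tube t X)) ⇔ (X ≡ A ⊎ X ≡ B))

module _ {n : ℕ} (G : Graph n) where

  data Walk : Tree n → Tree n → ℕ → Set where
    stop : ∀ {s t} → SameTubes s t → Walk s t 0
    move : ∀ {s u t k} → Rotation s u → SearchTree G u → Walk u t k →
           Walk s t (suc k)

  Diameter≡ : ℕ → Set
  Diameter≡ d =
    (∀ s t → SearchTree G s → SearchTree G t → ∃ λ k → k ≤ d × Walk s t k) ×
    (Σ (Tree n) λ s → Σ (Tree n) λ t → SearchTree G s × SearchTree G t ×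
       (∀ k → Walk s t k → d ≤ k))

{-# OPTIONS --safe #-}

-- A search tree on K p q is a word on the vertices: remove them in order until the
-- remaining ones lie in one part and become leaves, whose order is irrelevant.
-- Exchanging two adjacent letters from different parts A and B is always a rotation.
--
-- Upper bound: write a word as a shuffle of its A-letters π and B-letters σ. If i and j
-- exchanges lead to πσ and to σπ, then i + j = pq, and π (resp. σ) may be reordered for free
-- when it is at the end. For words with counts (i , j) and (i′ , j′), the route
-- σπ ~ σπ′ → π′σ ~ π′σ′ has length j + pq + i′, and the mirrored one i + pq + j′; since
-- i + j = i′ + j′ = pq, one of the two is at most 2pq.
--
-- Lower bound: go from B-ascending-then-A to B-descending-then-A. Charge an A–B rotation
-- to its B-vertex with weight 2, and a B–B rotation to both its vertices with weight 1.
-- Each b either swaps with all q − 1 ≥ 4p other B-vertices or at some time sits below all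
-- of A, which costs p rotations down and p up. Hence each b is charged at least 4p, and
-- each rotation pays at most 2.
module Submission where

open import Defs
open import Data.Bool using (Bool; true; false; if_then_else_)
open import Data.Bool.Properties using (¬-not) renaming (_≟_ to _≟ᵇ_)
open import Data.Empty using (⊥-elim) renaming (⊥ to Empty)
open import Data.Fin using (Fin; fromℕ<; _↑ˡ_; _↑ʳ_; splitAt; opposite) renaming (_<_ to _<ᶠ_; _<?_ to _<ᶠ?_)
import Data.Fin as Fin
open import Data.Fin.Properties using (any?; toℕ-↑ˡ; toℕ-↑ʳ; ↑ˡ-injective; ↑ʳ-injective; join-splitAt; opposite-prop; opposite-involutive; toℕ<n) renaming (_≟_ to _≟ᶠ_)
open import Data.Fin.Subset using (Subset; _∈_; _∉_; _⊆_; ⁅_⁆; _∪_; ⊥; ⊤; _-_)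
open import Data.Fin.Subset.Properties using (⊆-antisym; ∉⊥; ∈⊤; x∈⁅x⁆; x∈⁅y⁆⇒x≡y; x∈p∪q⁺; x∈p∪q⁻; x∈p∧x≢y⇒x∈p-y; p─q⊆p; x∈p⇒p-x⊂p; ∪-identityʳ; _∈?_)
open import Data.List using (List; []; _∷_; _++_; map; filter; allFin; length; tabulate)
open import Data.List.Properties using (++-identityʳ; filter-++; filter-all; filter-none; filter-reject; length-tabulate)
import Data.List.Membership.DecPropositional as DecMembership
open import Data.List.Membership.Propositional using (find) renaming (_∈_ to _∈ₗ_; _∉_ to _∉ₗ_)
open import Data.List.Membership.Propositional.Properties using (∈-map⁺; ∈-map⁻; ∈-filter⁺; ∈-filter⁻; ∈-allFin; ∈-∃++; ∈-tabulate⁺; ∈-tabulate⁻; ∈-++⁺ˡ; ∈-++⁺ʳ)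
open import Data.List.Membership.Propositional.Properties.WithK using (unique∧set⇒bag)
open import Data.List.Relation.Binary.BagAndSetEquality using (∼bag⇒↭)
open import Data.List.Relation.Binary.Permutation.Propositional using (_↭_; ↭-sym; ↭-refl; ↭-trans; ↭⇒↭ₛ; prep; swap)
open import Data.List.Relation.Binary.Permutation.Propositional.Properties using (∈-resp-↭; All-resp-↭; ↭-empty-inv; ↭-length; filter-↭; shift; drop-∷)
import Data.List.Relation.Binary.Permutation.Setoid.Properties as Permutationₛ
open import Data.List.Relation.Ternary.Interleaving.Propositional using (Interleaving; []; consˡ; consʳ)
open import Data.List.Relation.Ternary.Interleaving.Propositional.Properties using () renaming (filter⁺ to interleaving-filter)
open import Data.List.Relation.Unary.All using (All; []; _∷_)
import Data.List.Relation.Unary.All as All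
import Data.List.Relation.Unary.All.Properties as All
open import Data.List.Relation.Unary.AllPairs using ([]; _∷_)
import Data.List.Relation.Unary.AllPairs as AllPairs
import Data.List.Relation.Unary.AllPairs.Properties as AllPairs
open import Data.List.Relation.Unary.Any using (Any; here; there)
import Data.List.Relation.Unary.Any as Any
open import Data.List.Relation.Unary.Unique.Propositional using (Unique)
open import Data.List.Relation.Unary.Unique.Propositional.Properties using (Unique[x∷xs]⇒x∉xs)
import Data.List.Relation.Unary.Unique.Propositional.Properties as Unique
open import Data.Nat using (ℕ; zero; suc; _+_; _*_; _∸_; _⊓_; _≤_; _<_; _<?_)
open import Data.Nat.Properties
open import Data.Nat.Tactic.RingSolver using (solve-∀)
open import Data.Product using (∃; ∃₂; _×_; _,_; proj₁; proj₂)
open import Data.Sum using (_⊎_; inj₁; inj₂; [_,_]′)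
import Data.Sum as Sum
import Data.Vec.Properties as Vec
open import Function using (_∘_)
open import Function.Bundles using (_⇔_; mk⇔; Equivalence)
open import Level using (0ℓ)
open import Relation.Binary.PropositionalEquality using (_≡_; _≢_; refl; sym; trans; cong; cong₂; subst; subst₂; setoid)
open import Relation.Nullary using (¬_; Dec; yes; no; does; contradiction)
open import Relation.Nullary.Decidable using (_×-dec_; ¬?; decidable-stable; dec-true; dec-false)
open import Relation.Unary using (Pred; Decidable)

open Equivalence using (to; from)

-- Vertex sets and the lists that enumerate them.

fromList : ∀ {n} → List (Fin n) → Subset n
fromList []      = ⊥
fromList (x ∷ w) = ⁅ x ⁆ ∪ fromList w

∈-fromList⁺ : ∀ {n} {v : Fin n} {w} → v ∈ₗ w → v ∈ fromList w
∈-fromList⁺ {v = v} (here refl) = x∈p∪q⁺ (inj₁ (x∈⁅x⁆ v))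
∈-fromList⁺ (there v∈w)         = x∈p∪q⁺ (inj₂ (∈-fromList⁺ v∈w))

∈-fromList⁻ : ∀ {n} {v : Fin n} w → v ∈ fromList w → v ∈ₗ w
∈-fromList⁻ []      v∈⊥ = contradiction v∈⊥ ∉⊥
∈-fromList⁻ (x ∷ w) v∈  with x∈p∪q⁻ ⁅ x ⁆ (fromList w) v∈
... | inj₁ v∈x = here (x∈⁅y⁆⇒x≡y x v∈x)
... | inj₂ v∈w = there (∈-fromList⁻ w v∈w)

fromList-↭ : ∀ {n} {w w′ : List (Fin n)} → w ↭ w′ → fromList w ≡ fromList w′
fromList-↭ {w = w} {w′} w↭w′ = ⊆-antisym
  (∈-fromList⁺ ∘ ∈-resp-↭ w↭w′ ∘ ∈-fromList⁻ w)
  (∈-fromList⁺ ∘ ∈-resp-↭ (↭-sym w↭w′) ∘ ∈-fromList⁻ w′)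

⁅⁆-injective : ∀ {n} {x y : Fin n} → ⁅ x ⁆ ≡ ⁅ y ⁆ → x ≡ y
⁅⁆-injective {x = x} {y} eq = x∈⁅y⁆⇒x≡y y (subst (x ∈_) eq (x∈⁅x⁆ x))

∉-minus : ∀ {n} (S : Subset n) x → x ∉ S - x
∉-minus S x x∈ with x∈p⇒p-x⊂p (p─q⊆p S ⁅ x ⁆ x∈)
... | _ , y , y∈S , y∉ with y ≟ᶠ x
...   | yes refl = y∉ x∈
...   | no y≢x   = y∉ (x∈p∧x≢y⇒x∈p-y y∈S y≢x)

∈-minus⁻ : ∀ {n} {v : Fin n} S x → v ∈ S - x → v ∈ S × v ≢ x
∈-minus⁻ S x v∈ = p─q⊆p S ⁅ x ⁆ v∈ , λ { refl → ∉-minus S x v∈ }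

∪-minus : ∀ {n} {x : Fin n} {S} → x ∉ S → (⁅ x ⁆ ∪ S) - x ≡ S
∪-minus {x = x} {S} x∉S = ⊆-antisym
  (λ v∈ → let v∈∪ , v≢x = ∈-minus⁻ (⁅ x ⁆ ∪ S) x v∈ in
    [ (λ v∈x → contradiction (x∈⁅y⁆⇒x≡y x v∈x) v≢x) , (λ v∈S → v∈S) ]′ (x∈p∪q⁻ ⁅ x ⁆ S v∈∪))
  (λ v∈S → x∈p∧x≢y⇒x∈p-y (x∈p∪q⁺ (inj₂ v∈S)) λ { refl → x∉S v∈S })

minus-∪ : ∀ {n} {x : Fin n} {S} → x ∈ S → ⁅ x ⁆ ∪ (S - x) ≡ S
minus-∪ {x = x} {S} x∈S = ⊆-antisym
  (λ v∈ → [ (λ v∈x → subst (_∈ S) (sym (x∈⁅y⁆⇒x≡y x v∈x)) x∈S) , p─q⊆p S ⁅ x ⁆ ]′ (x∈p∪q⁻ ⁅ x ⁆ (S - x) v∈))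
  λ {v} v∈S → back v∈S (v ≟ᶠ x)
  where
  back : ∀ {v} → v ∈ S → Dec (v ≡ x) → v ∈ ⁅ x ⁆ ∪ (S - x)
  back v∈S (yes refl) = x∈p∪q⁺ (inj₁ (x∈⁅x⁆ x))
  back v∈S (no v≢x)   = x∈p∪q⁺ (inj₂ (x∈p∧x≢y⇒x∈p-y v∈S v≢x))

elements : ∀ {n} → Subset n → List (Fin n)
elements S = filter (_∈? S) (allFin _)

fromList-elements : ∀ {n} (S : Subset n) → fromList (elements S) ≡ S
fromList-elements S = ⊆-antisym
  (λ v∈ → proj₂ (∈-filter⁻ (_∈? S) {xs = allFin _} (∈-fromList⁻ (elements S) v∈)))
  (λ {v} v∈S → ∈-fromList⁺ (∈-filter⁺ (_∈? S) (∈-allFin v) v∈S))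

Unique-elements : ∀ {n} (S : Subset n) → Unique (elements S)
Unique-elements S = Unique.filter⁺ (_∈? S) (Unique.allFin⁺ _)

Complete : ∀ {n} → List (Fin n) → Set
Complete w = Unique w × ∀ v → v ∈ₗ w

complete-↭ : ∀ {n} {w w′ : List (Fin n)} → Complete w → Complete w′ → w ↭ w′
complete-↭ (u , a) (u′ , a′) = ∼bag⇒↭ (unique∧set⇒bag u u′ (mk⇔ (λ _ → a′ _) (λ _ → a _)))

Unique-resp-↭ : ∀ {n} {w w′ : List (Fin n)} → w ↭ w′ → Unique w → Unique w′
Unique-resp-↭ r = Permutationₛ.Unique-resp-↭ (setoid _) (↭⇒↭ₛ r)

complete-resp-↭ : ∀ {n} {w w′ : List (Fin n)} → w ↭ w′ → Complete w → Complete w′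
complete-resp-↭ r (u , a) = Unique-resp-↭ r u , λ v → ∈-resp-↭ r (a v)

fromList-complete : ∀ {n} {w : List (Fin n)} → Complete w → fromList w ≡ ⊤
fromList-complete (_ , a) = ⊆-antisym (λ _ → ∈⊤) (λ {v} _ → ∈-fromList⁺ (a v))

-- Distances between natural numbers.

-- The bound |a - b| ≤ k, written without subtraction. Both halves are carried because subtracting
-- from a constant interchanges them.
record Close (k a b : ℕ) : Set where
  constructor close
  field
    below : a ≤ k + b
    above : b ≤ k + a

close-reflexive : ∀ {k a b} → a ≡ b → Close k a b
close-reflexive refl = close (m≤n+m _ _) (m≤n+m _ _)

close-sym : ∀ {k a b} → Close k a b → Close k b a
close-sym (close l r) = close r l

close-suc : ∀ {a} → Close 1 a (suc a)
close-suc = close (m≤n+m _ 2) ≤-refl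

close-+ : ∀ {k l a b c d} → Close k a b → Close l c d → Close (k + l) (a + c) (b + d)
close-+ {k} {l} {a} {b} {c} {d} (close ab ba) (close cd dc) = close
  (≤-trans (+-mono-≤ ab cd) (≤-reflexive (arith k b l d)))
  (≤-trans (+-mono-≤ ba dc) (≤-reflexive (arith k a l c)))
  where
  arith : ∀ k b l d → (k + b) + (l + d) ≡ (k + l) + (b + d)
  arith = solve-∀

close-* : ∀ {k a b} m → Close k a b → Close (m * k) (m * a) (m * b)
close-* {k} {a} {b} m (close ab ba) = close
  (≤-trans (*-monoʳ-≤ m ab) (≤-reflexive (*-distribˡ-+ m k b)))
  (≤-trans (*-monoʳ-≤ m ba) (≤-reflexive (*-distribˡ-+ m k a)))

close-∸ : ∀ {k a b} c → Close k a b → Close k (c ∸ a) (c ∸ b)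
close-∸ {k} {a} {b} c (close ab ba) = close (half ba) (half ab)
  where
  half : ∀ {a b} → b ≤ k + a → c ∸ a ≤ k + (c ∸ b)
  half {a} {b} b≤ = m≤n+o⇒m∸n≤o c a (begin
    c                 ≤⟨ m≤n+m∸n c b ⟩
    b + (c ∸ b)       ≤⟨ +-monoˡ-≤ (c ∸ b) b≤ ⟩
    k + a + (c ∸ b)   ≡⟨ arith k a (c ∸ b) ⟩
    a + (k + (c ∸ b)) ∎)
    where
    open ≤-Reasoning
    arith : ∀ k a d → (k + a) + d ≡ a + (k + d)
    arith = solve-∀

-- Adding `k` distributes over `_⊓_`, so a minimum moves no further than its arguments. This lets
-- `charge` be bounded one history at a time.
close-⊓ : ∀ {k a b c d} → Close k a b → Close k c d → Close k (a ⊓ c) (b ⊓ d)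
close-⊓ {k} {a} {b} {c} {d} (close ab ba) (close cd dc) = close
  (subst (a ⊓ c ≤_) (sym (+-distribˡ-⊓ k b d)) (⊓-mono-≤ ab cd))
  (subst (b ⊓ d ≤_) (sym (+-distribˡ-⊓ k a c)) (⊓-mono-≤ ba dc))

module _ {A : Set} {P : Pred A 0ℓ} (P? : Decidable P) where

  count : List A → ℕ
  count w = length (filter P? w)

  count-reject : ∀ {x w} → ¬ P x → count (x ∷ w) ≡ count w
  count-reject ¬Px = cong length (filter-reject P? ¬Px)

  count-↭ : ∀ {w w′} → w ↭ w′ → count w ≡ count w′
  count-↭ r = ↭-length (filter-↭ P? r)

  count-close : ∀ x w → Close 1 (count w) (count (x ∷ w))
  count-close x w with P? x
  ... | yes _ = close-suc
  ... | no  _ = close-reflexive refl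

  count-move : ∀ x u w → count (x ∷ u) + count w ≡ count u + count (x ∷ w)
  count-move x u w with P? x
  ... | yes _ = sym (+-suc _ _)
  ... | no  _ = refl

-- Connectivity in a complete bipartite graph.

module Bipartite {n} (side : Fin n → Bool) (G : Graph n)
  (edge⇒≢ : ∀ {u v} → G u v → side u ≢ side v)
  (≢⇒edge : ∀ {u v} → side u ≢ side v → G u v) where

  open DecMembership (Vec.≡-dec {n = n} _≟ᵇ_) using () renaming (_∈?_ to _∈ₗ?_)

  -- The dichotomy that governs components: a mixed set is connected through vertices of the
  -- opposite side, so it is its own only component; any other set spans no edge and falls apart
  -- into singletons.
  Mixed : Subset n → Set
  Mixed S = ∃₂ λ u v → u ∈ S × v ∈ S × side u ≢ side v

  mixed? : ∀ S → Dec (Mixed S)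
  mixed? S = any? λ u → any? λ v → u ∈? S ×-dec v ∈? S ×-dec ¬? (side u ≟ᵇ side v)

  mono : ∀ {S u v} → ¬ Mixed S → u ∈ S → v ∈ S → side u ≡ side v
  mono {u = u} {v} ¬m u∈S v∈S =
    decidable-stable (side u ≟ᵇ side v) λ u≢v → ¬m (u , v , u∈S , v∈S , u≢v)

  opposite∈ : ∀ {S} → Mixed S → ∀ x → ∃ λ z → z ∈ S × side x ≢ side z
  opposite∈ (u , v , u∈S , v∈S , u≢v) x with side x ≟ᵇ side u
  ... | yes x≡u = v , v∈S , λ x≡v → u≢v (trans (sym x≡u) x≡v)
  ... | no x≢u  = u , u∈S , x≢u

  Mixed-⊆ : ∀ {S T} → S ⊆ T → Mixed S → Mixed T
  Mixed-⊆ S⊆T (u , v , u∈S , v∈S , u≢v) = u , v , S⊆T u∈S , S⊆T v∈S , u≢v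

  Mixed⇒Connected : ∀ {S} → Mixed S → Connected G S
  Mixed⇒Connected m {u} {v} u∈S v∈S with side u ≟ᵇ side v
  ... | no u≢v  = step u∈S (≢⇒edge u≢v) (here v∈S)
  ... | yes u≡v with opposite∈ m u
  ...   | z , z∈S , u≢z = step u∈S (≢⇒edge u≢z)
            (step z∈S (≢⇒edge (λ z≡v → u≢z (trans u≡v (sym z≡v)))) (here v∈S))

  Mixed⇒IsComponent : ∀ {S} → Mixed S → IsComponent G S S
  Mixed⇒IsComponent m@(u , _ , u∈S , _) = (λ v∈S → v∈S) , (u , u∈S) , Mixed⇒Connected m , λ _ v∈S _ → v∈S

  Reach-closed : ∀ {S C u v} → (∀ {x y} → x ∈ C → y ∈ S → G x y → y ∈ C) →
    u ∈ C → Reach G S u v → v ∈ C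
  Reach-closed closed u∈C (here _)       = u∈C
  -- The rest of the path is opened only to learn that `y ∈ S`, which `closed` asks for.
  Reach-closed closed u∈C (step _ e (here y∈S))   = closed u∈C y∈S e
  Reach-closed closed u∈C (step _ e r@(step y∈S _ _)) = Reach-closed closed (closed u∈C y∈S e) r

  component-mixed : ∀ {S C} → Mixed S → IsComponent G S C → C ≡ S
  component-mixed m (C⊆S , (u , u∈C) , _ , closed) =
    ⊆-antisym C⊆S λ v∈S → Reach-closed closed u∈C (Mixed⇒Connected m (C⊆S u∈C) v∈S)

  component-mono : ∀ {S C} → ¬ Mixed S → IsComponent G S C → ∃ λ x → x ∈ S × C ≡ ⁅ x ⁆
  component-mono {S} {C} ¬m (C⊆S , (x , x∈C) , conn , _) = x , C⊆S x∈C , ⊆-antisym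
    (λ v∈C → only (conn x∈C v∈C))
    (λ v∈x → subst (_∈ C) (sym (x∈⁅y⁆⇒x≡y x v∈x)) x∈C)
    where
    source : ∀ {u v} → Reach G C u v → u ∈ C
    source (here u∈C)     = u∈C
    source (step u∈C _ _) = u∈C
    only : ∀ {v} → Reach G C x v → v ∈ ⁅ x ⁆
    only (here _)       = x∈⁅x⁆ x
    only (step _ e r) = contradiction (mono ¬m (C⊆S x∈C) (C⊆S (source r))) (edge⇒≢ e)

  singleton-component : ∀ {S x} → ¬ Mixed S → x ∈ S → IsComponent G S ⁅ x ⁆
  singleton-component {S} {x} ¬m x∈S =
    (λ v∈x → subst (_∈ S) (sym (x∈⁅y⁆⇒x≡y x v∈x)) x∈S) ,
    (x , x∈⁅x⁆ x) ,
    conn ,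
    λ u∈x v∈S e → contradiction
      (mono ¬m (subst (_∈ S) (sym (x∈⁅y⁆⇒x≡y x u∈x)) x∈S) v∈S) (edge⇒≢ e)
    where
    conn : Connected G ⁅ x ⁆
    conn u∈x v∈x with refl ← x∈⁅y⁆⇒x≡y x u∈x with refl ← x∈⁅y⁆⇒x≡y x v∈x = here u∈x

  -- Words and their tubes.

  -- The tube rooted at x when S is the set of vertices still to be removed after x.
  top : Fin n → Subset n → Subset n
  top x S with mixed? (⁅ x ⁆ ∪ S)
  ... | yes _ = ⁅ x ⁆ ∪ S
  ... | no _  = ⁅ x ⁆

  top-mixed : ∀ {x S} → Mixed (⁅ x ⁆ ∪ S) → top x S ≡ ⁅ x ⁆ ∪ S
  top-mixed {x} {S} m with mixed? (⁅ x ⁆ ∪ S)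
  ... | yes _ = refl
  ... | no ¬m = contradiction m ¬m

  top-mono : ∀ {x S} → ¬ Mixed (⁅ x ⁆ ∪ S) → top x S ≡ ⁅ x ⁆
  top-mono {x} {S} ¬m with mixed? (⁅ x ⁆ ∪ S)
  ... | yes m = contradiction m ¬m
  ... | no _  = refl

  x∈top : ∀ x S → x ∈ top x S
  x∈top x S with mixed? (⁅ x ⁆ ∪ S)
  ... | yes _ = x∈p∪q⁺ (inj₁ (x∈⁅x⁆ x))
  ... | no _  = x∈⁅x⁆ x

  top⊆ : ∀ x S → top x S ⊆ ⁅ x ⁆ ∪ S
  top⊆ x S with mixed? (⁅ x ⁆ ∪ S)
  ... | yes _ = λ v∈ → v∈
  ... | no _  = λ v∈ → x∈p∪q⁺ (inj₁ v∈)

  -- A word lists the vertices in the order of their removal; once the remaining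
  -- vertices lie on one side they are leaves, and their order is irrelevant.
  tubes : List (Fin n) → List (Subset n)
  tubes []      = []
  tubes (x ∷ w) = top x (fromList w) ∷ tubes w

  tube⊆ : ∀ {X} w → X ∈ₗ tubes w → X ⊆ fromList w
  tube⊆ (x ∷ w) (here refl) v∈X = top⊆ x (fromList w) v∈X
  tube⊆ (x ∷ w) (there X∈)  v∈X = x∈p∪q⁺ (inj₂ (tube⊆ w X∈ v∈X))

  tube∋ : ∀ {y w} → y ∈ₗ w → ∃ λ X → X ∈ₗ tubes w × y ∈ X
  tube∋ {w = x ∷ w} (here refl) = _ , here refl , x∈top x (fromList w)
  tube∋ (there y∈w) = let X , X∈ , y∈X = tube∋ y∈w in X , there X∈ , y∈X

  mono-tail : ∀ {x w} → ¬ Mixed (fromList (x ∷ w)) → ¬ Mixed (fromList w)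
  mono-tail ¬m m = ¬m (Mixed-⊆ (λ v∈ → x∈p∪q⁺ (inj₂ v∈)) m)

  tubes-mono : ∀ w → ¬ Mixed (fromList w) → tubes w ≡ map ⁅_⁆ w
  tubes-mono []      ¬m = refl
  tubes-mono (x ∷ w) ¬m = cong₂ _∷_ (top-mono ¬m) (tubes-mono w (mono-tail {x} {w} ¬m))

  singleton-tube⁺ : ∀ {x w} → ¬ Mixed (fromList w) → x ∈ₗ w → ⁅ x ⁆ ∈ₗ tubes w
  singleton-tube⁺ {x} {w} ¬m x∈w = subst (⁅ x ⁆ ∈ₗ_) (sym (tubes-mono w ¬m)) (∈-map⁺ ⁅_⁆ x∈w)

  singleton-tube⁻ : ∀ {X w} → ¬ Mixed (fromList w) → X ∈ₗ tubes w → ∃ λ x → x ∈ₗ w × X ≡ ⁅ x ⁆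
  singleton-tube⁻ {X} {w} ¬m X∈ = ∈-map⁻ ⁅_⁆ (subst (X ∈ₗ_) (tubes-mono w ¬m) X∈)

  -- Translation between search trees and words.

  -- Compares tubes only, which is all that `Rotation` and `SameTubes` can see. One tree may have
  -- several words, differing in the order of its leaves.
  Represents : Tree n → List (Fin n) → Set
  Represents t w = ∀ X → Tube t X ⇔ X ∈ₗ tubes w

  leaf : Fin n → Tree n
  leaf x = node x []

  Tube-leaf : ∀ {x X} → Tube (leaf x) X → X ≡ ⁅ x ⁆
  Tube-leaf {x} root = ∪-identityʳ ⁅ x ⁆
  Tube-leaf (sub () _)

  leaf-IsSearchTree : ∀ x → IsSearchTree G (vset (leaf x)) (leaf x)
  leaf-IsSearchTree x = node (x∈p∪q⁺ (inj₁ (x∈⁅x⁆ x))) [] none []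
    where
    none : ∀ C → IsComponent G ((⁅ x ⁆ ∪ ⊥) - x) C → Any (λ c → vset c ≡ C) []
    none C (C⊆ , (y , y∈C) , _) = contradiction (subst (y ∈_) (∪-minus ∉⊥) (C⊆ y∈C)) ∉⊥

  vsets-leaves : ∀ w → vsets (map leaf w) ≡ fromList w
  vsets-leaves []      = refl
  vsets-leaves (x ∷ w) rewrite ∪-identityʳ ⁅ x ⁆ | vsets-leaves w = refl

  -- The tree is a path ending in a star: while the remaining vertices are mixed they form the
  -- single component below `x`, and as soon as they are not, each of them becomes a leaf.
  build : ∀ x w → Unique (x ∷ w) → Mixed (fromList (x ∷ w)) →
    ∃ λ t → IsSearchTree G (fromList (x ∷ w)) t × vset t ≡ fromList (x ∷ w) × Represents t (x ∷ w)
  build x w (x≢w ∷ uw) m with mixed? (fromList w)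
  build x w (x≢w ∷ uw) m | no ¬m =
    node x (map leaf w) ,
    node (x∈p∪q⁺ (inj₁ (x∈⁅x⁆ x)))
      (All.map⁺ (All.tabulate λ {c} c∈w →
        subst (λ S → IsComponent G S (vset (leaf c))) (sym rest)
          (subst (IsComponent G (fromList w)) (sym (∪-identityʳ ⁅ c ⁆)) (singleton-component ¬m (∈-fromList⁺ c∈w))) ,
        leaf-IsSearchTree c))
      (λ C comp → found (component-mono ¬m (subst (λ S → IsComponent G S C) rest comp)))
      (AllPairs.map⁺ (AllPairs.map
        (λ {a} {b} a≢b eq → a≢b (⁅⁆-injective (trans (sym (∪-identityʳ ⁅ a ⁆)) (trans eq (∪-identityʳ ⁅ b ⁆))))) uw)) ,
    vs ,
    λ X → mk⇔ fwd (bwd {X})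
    where
    rest : (⁅ x ⁆ ∪ fromList w) - x ≡ fromList w
    rest = ∪-minus λ x∈w → All.lookup x≢w (∈-fromList⁻ w x∈w) refl
    vs : vset (node x (map leaf w)) ≡ fromList (x ∷ w)
    vs = cong (⁅ x ⁆ ∪_) (vsets-leaves w)
    found : ∀ {C} → (∃ λ y → y ∈ fromList w × C ≡ ⁅ y ⁆) → Any (λ c → vset c ≡ C) (map leaf w)
    found (y , y∈ , refl) = Any.map (λ { refl → ∪-identityʳ ⁅ y ⁆ }) (∈-map⁺ leaf (∈-fromList⁻ w y∈))
    fwd : ∀ {X} → Tube (node x (map leaf w)) X → X ∈ₗ tubes (x ∷ w)
    fwd root = here (trans vs (sym (top-mixed m)))
    fwd (sub c∈ tb) with ∈-map⁻ leaf c∈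
    ... | y , y∈w , refl rewrite Tube-leaf tb = there (singleton-tube⁺ ¬m y∈w)
    bwd : ∀ {X} → X ∈ₗ tubes (x ∷ w) → Tube (node x (map leaf w)) X
    bwd (here refl) = subst (Tube _) (trans vs (sym (top-mixed m))) root
    bwd {X} (there X∈) with singleton-tube⁻ ¬m X∈
    ... | y , y∈w , refl = sub (∈-map⁺ leaf y∈w) (subst (Tube _) (∪-identityʳ ⁅ y ⁆) root)
  build x []         _          m | yes (_ , _ , u∈ , _) = contradiction u∈ ∉⊥
  build x w@(y ∷ w′) (x≢w ∷ uw) m | yes mw with build y w′ uw mw
  ... | t , st , vt , rt =
    node x (t ∷ []) ,
    node (x∈p∪q⁺ (inj₁ (x∈⁅x⁆ x)))
      ((subst (λ S → IsComponent G S (vset t)) (sym rest)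
          (subst (IsComponent G (fromList w)) (sym vt) (Mixed⇒IsComponent mw)) ,
        subst (λ S → IsSearchTree G S t) (sym vt) st) ∷ [])
      (λ C comp → here (trans vt (sym (component-mixed mw (subst (λ S → IsComponent G S C) rest comp)))))
      ([] ∷ []) ,
    vs ,
    λ X → mk⇔ fwd bwd
    where
    rest : (⁅ x ⁆ ∪ fromList w) - x ≡ fromList w
    rest = ∪-minus λ x∈w → All.lookup x≢w (∈-fromList⁻ w x∈w) refl
    vs : vset (node x (t ∷ [])) ≡ fromList (x ∷ w)
    vs = cong (⁅ x ⁆ ∪_) (trans (∪-identityʳ (vset t)) vt)
    fwd : ∀ {X} → Tube (node x (t ∷ [])) X → X ∈ₗ tubes (x ∷ w)
    fwd root = here (trans vs (sym (top-mixed m)))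
    fwd (sub (here refl) tb) = there (to (rt _) tb)
    bwd : ∀ {X} → X ∈ₗ tubes (x ∷ w) → Tube (node x (t ∷ [])) X
    bwd (here refl) = subst (Tube _) (trans vs (sym (top-mixed m))) root
    bwd (there X∈)  = sub (here refl) (from (rt _) X∈)

  singleton-tree : ∀ {x c} → vset c ≡ ⁅ x ⁆ → IsSearchTree G (vset c) c → c ≡ leaf x
  singleton-tree {x} {node r []} eq (node _ _ _ _) =
    cong leaf (⁅⁆-injective (trans (sym (∪-identityʳ ⁅ r ⁆)) eq))
  singleton-tree {x} {node r (d ∷ ts)} eq (node r∈ ((comp , _) ∷ _) _ _) with comp
  ... | d⊆ , (y , y∈d) , _ with ∈-minus⁻ (vset (node r (d ∷ ts))) r (d⊆ y∈d)
  ...   | y∈ , y≢r = contradiction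
          (trans (x∈⁅y⁆⇒x≡y x (subst (y ∈_) eq y∈)) (sym (x∈⁅y⁆⇒x≡y x (subst (r ∈_) eq r∈)))) y≢r

  -- If `S - r` is mixed, completeness forces a child and distinctness forbids two, since every
  -- component equals `S - r`; the recursion follows that child. Otherwise all children are leaves,
  -- and `elements` picks some order for them.
  word : ∀ {S t} → Mixed S → IsSearchTree G S t →
    ∃ λ w → Unique w × fromList w ≡ S × vset t ≡ S × Represents t w
  word {S} {node r ts} m (node r∈S cs complete distinct) with mixed? (S - r)
  word {S} {node r ts} m (node r∈S cs complete distinct) | no ¬m =
    r ∷ es ,
    All.tabulate (λ v∈ r≡v → proj₂ (∈-minus⁻ S r (∈es⁻ v∈)) (sym r≡v)) ∷ Unique-elements (S - r) ,
    fl ,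
    vs ,
    λ X → mk⇔ fwd (bwd {X})
    where
    es : List (Fin n)
    es = elements (S - r)
    fes : fromList es ≡ S - r
    fes = fromList-elements (S - r)
    ∈es⁻ : ∀ {v} → v ∈ₗ es → v ∈ S - r
    ∈es⁻ v∈ = subst (_ ∈_) fes (∈-fromList⁺ v∈)
    fl : fromList (r ∷ es) ≡ S
    fl = trans (cong (⁅ r ⁆ ∪_) fes) (minus-∪ r∈S)
    ¬m′ : ¬ Mixed (fromList es)
    ¬m′ = ¬m ∘ subst Mixed fes
    vset⊆ : ∀ {c v us} → c ∈ₗ us → v ∈ vset c → v ∈ vsets us
    vset⊆ (here refl) v∈c = x∈p∪q⁺ (inj₁ v∈c)
    vset⊆ (there c∈)  v∈c = x∈p∪q⁺ (inj₂ (vset⊆ c∈ v∈c))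
    child : ∀ {v} → v ∈ S - r → ∃ λ c → c ∈ₗ ts × vset c ≡ ⁅ v ⁆
    child v∈ = let c , c∈ , eq = find (complete _ (singleton-component ¬m v∈)) in c , c∈ , eq
    vsets⊆ : ∀ {us} → All (λ c → IsComponent G (S - r) (vset c) × IsSearchTree G (vset c) c) us →
      vsets us ⊆ S - r
    vsets⊆ [] v∈ = contradiction v∈ ∉⊥
    vsets⊆ {c ∷ us} (((c⊆ , _) , _) ∷ cs) v∈ with x∈p∪q⁻ (vset c) (vsets us) v∈
    ... | inj₁ v∈c  = c⊆ v∈c
    ... | inj₂ v∈us = vsets⊆ cs v∈us
    vs : vset (node r ts) ≡ S
    vs = trans (cong (⁅ r ⁆ ∪_) (⊆-antisym (vsets⊆ cs)
      (λ {v} v∈ → let c , c∈ , eq = child v∈ in vset⊆ c∈ (subst (v ∈_) (sym eq) (x∈⁅x⁆ v)))))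
      (minus-∪ r∈S)
    rootTube : vset (node r ts) ≡ top r (fromList es)
    rootTube = trans vs (trans (sym fl) (sym (top-mixed (subst Mixed (sym fl) m))))
    fwd : ∀ {X} → Tube (node r ts) X → X ∈ₗ tubes (r ∷ es)
    fwd root = here rootTube
    fwd {X} (sub c∈ tb) with All.lookup cs c∈
    ... | comp , st with component-mono ¬m comp
    ...   | x , x∈ , eq with refl ← singleton-tree eq st rewrite Tube-leaf tb =
      there (singleton-tube⁺ ¬m′ (∈-fromList⁻ es (subst (x ∈_) (sym fes) x∈)))
    bwd : ∀ {X} → X ∈ₗ tubes (r ∷ es) → Tube (node r ts) X
    bwd (here refl) = subst (Tube _) rootTube root
    bwd {X} (there X∈) with singleton-tube⁻ ¬m′ X∈
    ... | y , y∈ , refl with child (∈es⁻ y∈)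
    ...   | c , c∈ , eq = sub c∈ (subst (Tube c) eq root)
  word {S} {node r []} m (node r∈S cs complete distinct) | yes mr with complete _ (Mixed⇒IsComponent mr)
  ... | ()
  word {S} {node r (c ∷ d ∷ _)} m (node r∈S ((cc , _) ∷ (cd , _) ∷ _) complete ((c≢d ∷ _) ∷ _)) | yes mr =
    contradiction (trans (component-mixed mr cc) (sym (component-mixed mr cd))) c≢d
  word {S} {node r (c ∷ [])} m (node r∈S ((cc , sc) ∷ []) complete _) | yes mr
    with word (subst Mixed (sym (component-mixed mr cc)) mr) sc
  ... | w , uw , fw , vc , rc =
    r ∷ w ,
    All.tabulate (λ v∈ r≡v → proj₂ (∈-minus⁻ S r (subst (_ ∈_) fw′ (∈-fromList⁺ v∈))) (sym r≡v)) ∷ uw ,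
    fl ,
    vs ,
    λ X → mk⇔ fwd bwd
    where
    fw′ : fromList w ≡ S - r
    fw′ = trans fw (component-mixed mr cc)
    fl : fromList (r ∷ w) ≡ S
    fl = trans (cong (⁅ r ⁆ ∪_) fw′) (minus-∪ r∈S)
    vs : vset (node r (c ∷ [])) ≡ S
    vs = trans (cong (⁅ r ⁆ ∪_) (trans (∪-identityʳ (vset c)) (component-mixed mr cc))) (minus-∪ r∈S)
    rootTube : vset (node r (c ∷ [])) ≡ top r (fromList w)
    rootTube = trans vs (trans (sym fl) (sym (top-mixed (subst Mixed (sym fl) m))))
    fwd : ∀ {X} → Tube (node r (c ∷ [])) X → X ∈ₗ tubes (r ∷ w)
    fwd root = here rootTube
    fwd (sub (here refl) tb) = there (to (rc _) tb)
    bwd : ∀ {X} → X ∈ₗ tubes (r ∷ w) → Tube (node r (c ∷ [])) X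
    bwd (here refl) = subst (Tube _) rootTube root
    bwd (there X∈)  = sub (here refl) (from (rc _) X∈)

  -- Rotations of words.

  SymDiff : List (Fin n) → List (Fin n) → Subset n → Set
  SymDiff w w′ X = (X ∈ₗ tubes w × X ∉ₗ tubes w′) ⊎ (X ∈ₗ tubes w′ × X ∉ₗ tubes w)

  Rotates : List (Fin n) → List (Fin n) → Set
  Rotates w w′ = ∃₂ λ A B → A ≢ B × (∀ X → SymDiff w w′ X ⇔ (X ≡ A ⊎ X ≡ B))

  SymDiff-⇔ : ∀ {w w′ t t′ X} → Represents t w → Represents t′ w′ →
    ((Tube t X × ¬ Tube t′ X) ⊎ (Tube t′ X × ¬ Tube t X)) ⇔ SymDiff w w′ X
  SymDiff-⇔ {X = X} r r′ = mk⇔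
    [ (λ (a , b) → inj₁ (to (r X) a , b ∘ from (r′ X))) , (λ (a , b) → inj₂ (to (r′ X) a , b ∘ from (r X))) ]′
    [ (λ (a , b) → inj₁ (from (r X) a , b ∘ to (r′ X))) , (λ (a , b) → inj₂ (from (r′ X) a , b ∘ to (r X))) ]′

  Rotates⇒Rotation : ∀ {w w′ t t′} → Represents t w → Represents t′ w′ → Rotates w w′ → Rotation t t′
  Rotates⇒Rotation r r′ (A , B , A≢B , e) = A , B , A≢B , λ X →
    mk⇔ (to (e X) ∘ to (SymDiff-⇔ r r′)) (from (SymDiff-⇔ r r′) ∘ from (e X))

  Rotation⇒Rotates : ∀ {w w′ t t′} → Represents t w → Represents t′ w′ → Rotation t t′ → Rotates w w′
  Rotation⇒Rotates r r′ (A , B , A≢B , e) = A , B , A≢B , λ X →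
    mk⇔ (to (e X) ∘ from (SymDiff-⇔ r r′)) (to (SymDiff-⇔ r r′) ∘ from (e X))

  ∉tube : ∀ {x X} w → x ∉ₗ w → X ∈ₗ tubes w → x ∉ X
  ∉tube w x∉w X∈ x∈X = x∉w (∈-fromList⁻ w (tube⊆ w X∈ x∈X))

  top-↭ : ∀ {x w w′} → w ↭ w′ → top x (fromList w) ≡ top x (fromList w′)
  top-↭ {x} w↭w′ = cong (top x) (fromList-↭ w↭w′)

  -- The new head tube contains `x` and no tube of either tail does, so it cannot cancel a
  -- difference.
  SymDiff-∷ : ∀ {x w w′ X} → Unique (x ∷ w) → w ↭ w′ → SymDiff w w′ X → SymDiff (x ∷ w) (x ∷ w′) X
  SymDiff-∷ {x} {w} {w′} u r = [ (λ (X∈ , X∉) → inj₁ (there X∈ , lift (∉tube w x∉w X∈) X∉)) ,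
                                 (λ (X∈ , X∉) → inj₂ (there X∈ , lift (∉tube w′ x∉w′ X∈) X∉)) ]′
    where
    x∉w : x ∉ₗ w
    x∉w = Unique[x∷xs]⇒x∉xs u
    x∉w′ : x ∉ₗ w′
    x∉w′ = x∉w ∘ ∈-resp-↭ (↭-sym r)
    lift : ∀ {X S v} → x ∉ X → X ∉ₗ tubes v → X ∉ₗ (top x S ∷ tubes v)
    lift x∉X X∉ (here refl) = x∉X (x∈top x _)
    lift x∉X X∉ (there X∈)  = X∉ X∈

  rotates-∷ : ∀ {x w w′} → Unique (x ∷ w) → w ↭ w′ → Rotates w w′ → Rotates (x ∷ w) (x ∷ w′)
  rotates-∷ {x} {w} {w′} u r (A , B , A≢B , e) = A , B , A≢B , λ X →
    mk⇔ f (SymDiff-∷ u r ∘ from (e X))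
    where
    h = top-↭ {x} r
    f : ∀ {X} → SymDiff (x ∷ w) (x ∷ w′) X → X ≡ A ⊎ X ≡ B
    f (inj₁ (here eq , X∉))  = contradiction (here (trans eq h)) X∉
    f (inj₁ (there X∈ , X∉)) = to (e _) (inj₁ (X∈ , X∉ ∘ there))
    f (inj₂ (here eq , X∉))  = contradiction (here (trans eq (sym h))) X∉
    f (inj₂ (there X∈ , X∉)) = to (e _) (inj₂ (X∈ , X∉ ∘ there))

  swap-top : ∀ {x y w} → side x ≢ side y → top x (fromList (y ∷ w)) ≡ top y (fromList (x ∷ w))
  swap-top {x} {y} {w} x≢y = trans (top-mixed m) (trans eq (sym (top-mixed (subst Mixed eq m))))
    where
    eq : fromList (x ∷ y ∷ w) ≡ fromList (y ∷ x ∷ w)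
    eq = fromList-↭ {w = x ∷ y ∷ w} (swap x y ↭-refl)
    m : Mixed (fromList (x ∷ y ∷ w))
    m = x , y , ∈-fromList⁺ {w = x ∷ y ∷ w} (here refl) , ∈-fromList⁺ {w = x ∷ y ∷ w} (there (here refl)) , x≢y

  -- The head tube is the whole mixed set before and after, and the tubes of `w` stay. Only the tube
  -- in second place changes: `A`, which contains `y` but not `x`, gives way to `B`, which contains
  -- `x` but not `y`.
  rotates-swap : ∀ {x y w} → Unique (x ∷ y ∷ w) → side x ≢ side y → Rotates (x ∷ y ∷ w) (y ∷ x ∷ w)
  rotates-swap {x} {y} {w} ((x≢y ∷ x≢w) ∷ y≢w ∷ _) sx≢sy =
    A , B , (λ A≡B → x∉A (subst (x ∈_) (sym A≡B) x∈B)) , λ X → mk⇔ f g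
    where
    A = top y (fromList w)
    B = top x (fromList w)
    x∈B : x ∈ B
    x∈B = x∈top x (fromList w)
    y∈A : y ∈ A
    y∈A = x∈top y (fromList w)
    x∉w : x ∉ₗ w
    x∉w x∈ = All.lookup x≢w x∈ refl
    y∉w : y ∉ₗ w
    y∉w y∈ = All.lookup y≢w y∈ refl
    x∉A : x ∉ A
    x∉A = ∉tube (y ∷ w) (λ { (here x≡y) → x≢y x≡y ; (there x∈) → x∉w x∈ }) (here refl)
    y∉B : y ∉ B
    y∉B = ∉tube (x ∷ w) (λ { (here y≡x) → x≢y (sym y≡x) ; (there y∈) → y∉w y∈ }) (here refl)
    h = swap-top {x} {y} {w} sx≢sy
    f : ∀ {X} → SymDiff (x ∷ y ∷ w) (y ∷ x ∷ w) X → X ≡ A ⊎ X ≡ B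
    f (inj₁ (here eq , X∉))          = contradiction (here (trans eq h)) X∉
    f (inj₁ (there (here eq) , _))   = inj₁ eq
    f (inj₁ (there (there X∈) , X∉)) = contradiction (there (there X∈)) X∉
    f (inj₂ (here eq , X∉))          = contradiction (here (trans eq (sym h))) X∉
    f (inj₂ (there (here eq) , _))   = inj₂ eq
    f (inj₂ (there (there X∈) , X∉)) = contradiction (there (there X∈)) X∉
    g : ∀ {X} → X ≡ A ⊎ X ≡ B → SymDiff (x ∷ y ∷ w) (y ∷ x ∷ w) X
    g (inj₁ refl) = inj₁ (there (here refl) , λ
      { (here eq)          → x∉A (subst (x ∈_) (sym (trans eq (sym h))) (x∈top x _))
      ; (there (here eq))  → x∉A (subst (x ∈_) (sym eq) x∈B)
      ; (there (there A∈)) → ∉tube w y∉w A∈ y∈A })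
    g (inj₂ refl) = inj₂ (there (here refl) , λ
      { (here eq)          → y∉B (subst (y ∈_) (sym (trans eq h)) (x∈top y _))
      ; (there (here eq))  → y∉B (subst (y ∈_) (sym eq) y∈A)
      ; (there (there B∈)) → ∉tube w x∉w B∈ x∈B })

  -- Flips, free reorderings and the upper bound.

  data Flip : List (Fin n) → List (Fin n) → Set where
    swap : ∀ {x y w} → side x ≢ side y → Flip (x ∷ y ∷ w) (y ∷ x ∷ w)
    skip : ∀ {x w w′} → Flip w w′ → Flip (x ∷ w) (x ∷ w′)

  Flip⇒↭ : ∀ {w w′} → Flip w w′ → w ↭ w′
  Flip⇒↭ (swap _) = _↭_.swap _ _ ↭-refl
  Flip⇒↭ (skip f) = prep _ (Flip⇒↭ f)

  Flip-sym : ∀ {w w′} → Flip w w′ → Flip w′ w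
  Flip-sym (swap x≢y) = swap (λ y≡x → x≢y (sym y≡x))
  Flip-sym (skip f)   = skip (Flip-sym f)

  Flip⇒Rotates : ∀ {w w′} → Unique w → Flip w w′ → Rotates w w′
  Flip⇒Rotates u (swap x≢y) = rotates-swap u x≢y
  Flip⇒Rotates {x ∷ w} u@(_ ∷ uw) (skip f) =
    rotates-∷ u (Flip⇒↭ f) (Flip⇒Rotates uw f)

  SameTubesʷ : List (Fin n) → List (Fin n) → Set
  SameTubesʷ w w′ = ∀ X → X ∈ₗ tubes w ⇔ X ∈ₗ tubes w′

  -- Only flips are counted; a `same` step changes the word but not the tubes. It stores a
  -- permutation because head tubes must still agree after a letter is put in front, and because the
  -- word must remain complete.
  data Path : List (Fin n) → List (Fin n) → ℕ → Set where
    done : ∀ {w} → Path w w 0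
    flip : ∀ {w w₁ w₂ k} → Flip w w₁ → Path w₁ w₂ k → Path w w₂ (suc k)
    same : ∀ {w w₁ w₂ k} → w ↭ w₁ → SameTubesʷ w w₁ → Path w₁ w₂ k → Path w w₂ k

  infixr 5 _▷_
  _▷_ : ∀ {w₁ w₂ w₃ i j} → Path w₁ w₂ i → Path w₂ w₃ j → Path w₁ w₃ (i + j)
  done       ▷ q = q
  flip f p   ▷ q = flip f (p ▷ q)
  same r e p ▷ q = same r e (p ▷ q)

  Path-sym : ∀ {w w′ k} → Path w w′ k → Path w′ w k
  Path-sym done = done
  Path-sym (flip {k = k} f p) = subst (Path _ _) (+-comm k 1) (Path-sym p ▷ flip (Flip-sym f) done)
  Path-sym (same {k = k} r e p) = subst (Path _ _) (+-identityʳ k)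
    (Path-sym p ▷ same (↭-sym r) (λ X → mk⇔ (from (e X)) (to (e X))) done)

  SameTubes-∷ : ∀ {x w w′} → w ↭ w′ → SameTubesʷ w w′ → SameTubesʷ (x ∷ w) (x ∷ w′)
  SameTubes-∷ {x} r e X = mk⇔
    (λ { (here eq) → here (trans eq (top-↭ {x} r)) ; (there X∈) → there (to (e X) X∈) })
    (λ { (here eq) → here (trans eq (sym (top-↭ {x} r))) ; (there X∈) → there (from (e X) X∈) })

  Path-∷ : ∀ {w w′ k} x → Path w w′ k → Path (x ∷ w) (x ∷ w′) k
  Path-∷ x done         = done
  Path-∷ x (flip f p)   = flip (skip f) (Path-∷ x p)
  Path-∷ x (same r e p) = same (prep x r) (SameTubes-∷ r e) (Path-∷ x p)

  one-sided : ∀ {b w} → All (λ v → side v ≡ b) w → ¬ Mixed (fromList w)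
  one-sided {w = w} aw (u , v , u∈ , v∈ , u≢v) =
    u≢v (trans (All.lookup aw (∈-fromList⁻ w u∈)) (sym (All.lookup aw (∈-fromList⁻ w v∈))))

  -- A one-sided final block contributes exactly its singletons as tubes, in whatever order, and the
  -- head tubes above it depend only on its vertex set.
  reorder-tail : ∀ us {m m′} → ¬ Mixed (fromList m) → m ↭ m′ → Path (us ++ m) (us ++ m′) 0
  reorder-tail []       ¬m r = same r (λ X → mk⇔
    (λ X∈ → let _ , x∈ , X≡ = singleton-tube⁻ ¬m X∈ in subst (_∈ₗ _) (sym X≡) (singleton-tube⁺ ¬m′ (∈-resp-↭ r x∈)))
    (λ X∈ → let _ , x∈ , X≡ = singleton-tube⁻ ¬m′ X∈ in subst (_∈ₗ _) (sym X≡) (singleton-tube⁺ ¬m (∈-resp-↭ (↭-sym r) x∈)))) done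
    where ¬m′ = ¬m ∘ subst Mixed (sym (fromList-↭ r))
  reorder-tail (x ∷ us) ¬m r = Path-∷ x (reorder-tail us ¬m r)

  pass : ∀ {x} ys {zs} → All (λ y → side x ≢ side y) ys → Path (x ∷ ys ++ zs) (ys ++ x ∷ zs) (length ys)
  pass []       []           = done
  pass (y ∷ ys) (x≢y ∷ x≢ys) = flip (swap x≢y) (Path-∷ y (pass ys x≢ys))

  Apart : List (Fin n) → List (Fin n) → Set
  Apart xs ys = All (λ x → All (λ y → side x ≢ side y) ys) xs

  exchange : ∀ {xs ys} → Apart xs ys → Path (xs ++ ys) (ys ++ xs) (length xs * length ys)
  exchange {[]}     {ys} [] = subst (λ zs → Path ys zs 0) (sym (++-identityʳ ys)) done
  exchange {x ∷ xs} {ys} (x≢ys ∷ ap) = subst (Path _ _) (+-comm (length xs * length ys) (length ys))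
    (Path-∷ x (exchange ap) ▷ pass ys x≢ys)

  -- Each pair of one letter from `xs` and one from `ys` is out of order with respect to exactly one
  -- of the two targets, so the two costs add up to the number of pairs.
  unshuffle : ∀ {xs ys w} → Apart xs ys → Interleaving xs ys w →
    ∃₂ λ i j → Path w (xs ++ ys) i × Path w (ys ++ xs) j × i + j ≡ length xs * length ys
  unshuffle ap [] = 0 , 0 , done , done , refl
  unshuffle {x ∷ xs} {ys} (x≢ys ∷ ap) (consˡ sp) with unshuffle ap sp
  ... | i , j , up , down , eq = i , j + length ys ,
    Path-∷ x up ,
    Path-∷ x down ▷ pass ys x≢ys ,
    trans (sym (+-assoc i j (length ys))) (trans (cong (_+ length ys) eq) (+-comm _ (length ys)))
  unshuffle {xs} {y ∷ ys} ap (consʳ sp) with unshuffle (All.map All.tail ap) sp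
  ... | i , j , up , down , eq = i + length xs , j ,
    Path-∷ y up ▷ pass xs (All.map (λ x≢ y≡x → All.head x≢ (sym y≡x)) ap) ,
    Path-∷ y down ,
    trans (arith i (length xs) j) (trans (cong (length xs +_) eq) (sym (*-suc (length xs) (length ys))))
    where
    arith : ∀ a b c → (a + b) + c ≡ b + (a + c)
    arith = solve-∀

  inA? : ∀ v → Dec (side v ≡ true)
  inA? v = side v ≟ᵇ true

  inB? : ∀ v → Dec (¬ side v ≡ true)
  inB? v = ¬? (inA? v)

  As Bs : List (Fin n) → List (Fin n)
  As = filter inA?
  Bs = filter inB?

  A≢B : ∀ {x y} → side x ≡ true → ¬ side y ≡ true → side x ≢ side y
  A≢B x∈A y∉A x≡y = y∉A (trans (sym x≡y) x∈A)

  apart : ∀ w w′ → Apart (As w) (Bs w′)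
  apart w w′ = All.map (λ x∈A → All.map (A≢B x∈A) (All.all-filter inB? w′)) (All.all-filter inA? w)

  apart′ : ∀ w w′ → Apart (Bs w) (As w′)
  apart′ w w′ = All.map (λ x∉A → All.map (λ y∈A x≡y → A≢B y∈A x∉A (sym x≡y)) (All.all-filter inA? w′)) (All.all-filter inB? w)

  As-mono : ∀ w → ¬ Mixed (fromList (As w))
  As-mono w = one-sided (All.all-filter inA? w)

  Bs-mono : ∀ w → ¬ Mixed (fromList (Bs w))
  Bs-mono w = one-sided (All.map ¬-not (All.all-filter inB? w))

  path≤ : ∀ {w w′} → w ↭ w′ → ∃ λ k → k ≤ 2 * (length (As w) * length (Bs w)) × Path w w′ k
  path≤ {w} {w′} r
    with unshuffle (apart w w) (interleaving-filter inA? w) | unshuffle (apart w′ w′) (interleaving-filter inA? w′)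
  ... | i , j , up , down , eq | i′ , j′ , up′ , down′ , eq′ with ≤-total i′ i
  -- As i + j = i′ + j′, comparing `i′` with `i` settles which route is short: here j + i′ ≤ i + j,
  -- and in the other case i + j′ ≤ i′ + j′.
  ...   | inj₁ i′≤i =
    j + (length (Bs w) * length (As w′) + i′) ,
    bound eq (trans (*-comm (length (Bs w)) _) (cong (_* length (Bs w)) (↭-length (↭-sym ra)))) i′≤i ,
    (down ▷ reorder-tail (Bs w) (As-mono w) ra
      ▷ exchange (apart′ w w′)
      ▷ reorder-tail (As w′) (Bs-mono w) rb ▷ Path-sym up′)
    where
    ra = filter-↭ inA? r
    rb = filter-↭ inB? r
    bound : ∀ {N M} → i + j ≡ N → M ≡ N → i′ ≤ i → j + (M + i′) ≤ 2 * N
    bound refl refl le = begin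
      j + ((i + j) + i′) ≤⟨ +-monoʳ-≤ j (+-monoʳ-≤ (i + j) le) ⟩
      j + ((i + j) + i)  ≡⟨ arith i j ⟩
      2 * (i + j)        ∎
      where
      open ≤-Reasoning
      arith : ∀ i j → j + ((i + j) + i) ≡ 2 * (i + j)
      arith = solve-∀
  ...   | inj₂ i≤i′ =
    i + (length (As w) * length (Bs w′) + j′) ,
    bound (trans eq′ (cong₂ _*_ (↭-length (↭-sym ra)) (↭-length (↭-sym rb))))
      (cong (length (As w) *_) (↭-length (↭-sym rb))) i≤i′ ,
    (up ▷ reorder-tail (As w) (Bs-mono w) rb
      ▷ exchange (apart w w′)
      ▷ reorder-tail (Bs w′) (As-mono w) ra ▷ Path-sym down′)
    where
    ra = filter-↭ inA? r
    rb = filter-↭ inB? r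
    bound : ∀ {N M} → i′ + j′ ≡ N → M ≡ N → i ≤ i′ → i + (M + j′) ≤ 2 * N
    bound refl refl le = begin
      i + ((i′ + j′) + j′)  ≤⟨ +-monoˡ-≤ _ le ⟩
      i′ + ((i′ + j′) + j′) ≡⟨ arith i′ j′ ⟩
      2 * (i′ + j′)         ∎
      where
      open ≤-Reasoning
      arith : ∀ i j → i + ((i + j) + j) ≡ 2 * (i + j)
      arith = solve-∀

  -- Realising paths of words as walks of search trees.

  completeTree : ∀ {w} → Mixed ⊤ → Complete w → ∃ λ t → SearchTree G t × Represents t w
  completeTree {[]} (u , _) (_ , a) with () ← a u
  completeTree {x ∷ w} m c@(u , _) with fromList-complete c
  ... | full with build x w u (subst Mixed (sym full) m)
  ...   | t , st , _ , r = t , subst (λ S → IsSearchTree G S t) full st , r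

  completeWord : ∀ {t} → Mixed ⊤ → SearchTree G t → ∃ λ w → Complete w × Represents t w
  completeWord m st with word m st
  ... | w , u , full , _ , r = w , (u , λ v → ∈-fromList⁻ w (subst (v ∈_) (sym full) ∈⊤)) , r

  -- Each flip needs an actual next tree, supplied by `completeTree`. A `same` step keeps the tree
  -- `s` and only replaces the word representing it.
  realise : ∀ {w w′ s t k} → Mixed ⊤ → Complete w → Represents s w → Represents t w′ → Path w w′ k → Walk G s t k
  realise m c rs rt done = stop λ X → mk⇔ (from (rt X) ∘ to (rs X)) (from (rs X) ∘ to (rt X))
  realise m c rs rt (same r e p) = realise m (complete-resp-↭ r c)
    (λ X → mk⇔ (to (e X) ∘ to (rs X)) (from (rs X) ∘ from (e X))) rt p
  realise m c@(u , _) rs rt (flip f p) with complete-resp-↭ (Flip⇒↭ f) c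
  ... | c₁ with completeTree m c₁
  ...   | _ , st , rt₁ = move (Rotates⇒Rotation rs rt₁ (Flip⇒Rotates u f)) st (realise m c₁ rt₁ rt p)

  -- The shape of an arbitrary rotation.

  -- `X` misses `x`, so it is not the head tube, which by mixedness is the whole set; it contains
  -- `y`, so it is not a tube after `y` has been removed.
  foreign : ∀ {x y w w′ X} → x ∷ w ↭ y ∷ w′ → Unique (x ∷ w) → Mixed (fromList (x ∷ w)) →
    X ∈ₗ tubes w → y ∈ X → X ∉ₗ tubes (y ∷ w′)
  foreign {x} {y} {w} {w′} r u m X∈ y∈X (here refl) = ∉tube w (Unique[x∷xs]⇒x∉xs u) X∈
    (subst (x ∈_) (sym (trans (top-mixed (subst Mixed (fromList-↭ r) m)) (sym (fromList-↭ r))))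
      (∈-fromList⁺ {w = x ∷ w} (here refl)))
  foreign {w′ = w′} r u m X∈ y∈X (there X∈′) =
    ∉tube w′ (Unique[x∷xs]⇒x∉xs (Unique-resp-↭ r u)) X∈′ y∈X

  other∈ : ∀ {x y} {w w′ : List (Fin n)} → x ≢ y → x ∷ w ↭ y ∷ w′ → y ∈ₗ w
  other∈ x≢y r with ∈-resp-↭ (↭-sym r) (here refl)
  ... | here y≡x  = contradiction (sym y≡x) x≢y
  ... | there y∈w = y∈w

  -- What the lower bound uses of a rotation. Unlike `Rotates` it names no tubes, so it passes to
  -- tails by `SymDiff-∷` alone and to the reverse direction by exchanging the two cases.
  AtMostTwo : (Subset n → Set) → Set
  AtMostTwo P = ∀ {X Y Z} → P X → P Y → P Z → X ≢ Y → X ≢ Z → Y ≢ Z → Empty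

  Rotates⇒AtMostTwo : ∀ {w w′} → Rotates w w′ → AtMostTwo (SymDiff w w′)
  Rotates⇒AtMostTwo (A , B , _ , e) {X} {Y} {Z} x y z X≢Y X≢Z Y≢Z with to (e X) x | to (e Y) y | to (e Z) z
  ... | inj₁ refl | inj₁ refl | _         = X≢Y refl
  ... | inj₁ refl | inj₂ _    | inj₁ refl = X≢Z refl
  ... | inj₁ _    | inj₂ refl | inj₂ refl = Y≢Z refl
  ... | inj₂ _    | inj₁ refl | inj₁ refl = Y≢Z refl
  ... | inj₂ refl | inj₁ _    | inj₂ refl = X≢Z refl
  ... | inj₂ refl | inj₂ refl | _         = X≢Y refl

  -- Every tube of w containing y is lost, and at most one of them may be: so y comes first
  -- in w, unless all of w are leaves and y can be moved there.
  second : ∀ {x y w w′ X′} → x ≢ y → x ∷ w ↭ y ∷ w′ → Unique (x ∷ w) → Mixed (fromList (x ∷ w)) →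
    AtMostTwo (SymDiff (x ∷ w) (y ∷ w′)) → SymDiff (x ∷ w) (y ∷ w′) X′ → x ∈ X′ →
    ∃ λ r → w ↭ y ∷ r × (w ≡ y ∷ r ⊎ ¬ Mixed (fromList w))
  second {x} {y} {w} x≢y r u m two sd′ x∈X′ with mixed? (fromList w)
  ... | no ¬m with us , vs , refl ← ∈-∃++ (other∈ x≢y r) = us ++ vs , shift y us vs , inj₂ ¬m
  second {x} {y} {[]} x≢y r u m two sd′ x∈X′ | yes (_ , _ , u∈ , _) = contradiction u∈ ∉⊥
  second {x} {y} {z ∷ w} {w′} {X′} x≢y r u@(_ ∷ uw) m two sd′ x∈X′ | yes mw with z ≟ᶠ y
  ... | yes refl = w , ↭-refl , inj₁ refl
  ... | no z≢y with other∈ x≢y r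
  ...   | here y≡z  = contradiction (sym y≡z) z≢y
  ...   | there y∈w with tube∋ y∈w
  -- With `z` in front of `y`, the head tube of `z ∷ w` and the tube `X` further down both contain
  -- `y` and are lost. Together with `X′` they are three changes: `X` misses `z`, and `X′` alone
  -- contains `x`.
  ...     | X , X∈ , y∈X = ⊥-elim (two (lost (here refl) y∈T) (lost (there X∈) y∈X) sd′
    (λ T≡X → ∉tube w (Unique[x∷xs]⇒x∉xs uw) X∈ (subst (z ∈_) T≡X (x∈top z _)))
    (λ T≡X′ → ∉tube (z ∷ w) (Unique[x∷xs]⇒x∉xs u) (here refl) (subst (x ∈_) (sym T≡X′) x∈X′))
    (λ X≡X′ → ∉tube (z ∷ w) (Unique[x∷xs]⇒x∉xs u) (there X∈) (subst (x ∈_) (sym X≡X′) x∈X′)))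
    where
    y∈T : y ∈ top z (fromList w)
    y∈T = subst (y ∈_) (sym (top-mixed mw)) (∈-fromList⁺ {w = z ∷ w} (there y∈w))
    lost : ∀ {Z} → Z ∈ₗ tubes (z ∷ w) → y ∈ Z → SymDiff (x ∷ z ∷ w) (y ∷ w′) Z
    lost Z∈ y∈Z = inj₁ (there Z∈ , foreign r u m Z∈ y∈Z)

  -- The potential and its change under rotations.

  module Potential (p : ℕ) where

    before? : ∀ (b v : Fin n) → Dec (¬ side v ≡ true × v <ᶠ b)
    before? b v = inB? v ×-dec v <ᶠ? b

    after? : ∀ (b v : Fin n) → Dec (¬ side v ≡ true × b <ᶠ v)
    after? b v = inB? v ×-dec b <ᶠ? v

    -- The number of B-vertices whose order relative to `b` is not ascending: smaller ones that are
    -- not above `b`, and larger ones that are. When A occupies the first `p` indices, `toℕ b ∸ p`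
    -- counts the smaller vertices of B.
    disorder : Fin n → List (Fin n) → ℕ
    disorder b pre = (Fin.toℕ b ∸ p ∸ count (before? b) pre) + count (after? b) pre

    -- The minimum over the two possible histories of b, when pre is the set of vertices above b:
    -- if b has been below all of A, it paid 2p to get there and 2 for each vertex of A passed
    -- on the way back; if not, it paid for all order changes within B. The truncated
    -- subtractions are exact on duplicate-free words.
    charge : Fin n → List (Fin n) → ℕ
    charge b pre = (4 * p ∸ 2 * count inA? pre) ⊓ (2 * count inA? pre + disorder b pre)

    cost : Fin n → List (Fin n) → ℕ
    cost x pre = if does (inA? x) then 0 else charge x pre

    potential : List (Fin n) → List (Fin n) → ℕ
    potential pre []      = 0
    potential pre (x ∷ w) = cost x pre + potential (x ∷ pre) w

    charge-↭ : ∀ b {pre pre′} → pre ↭ pre′ → charge b pre ≡ charge b pre′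
    charge-↭ b r = cong₂ (λ a d → (4 * p ∸ 2 * a) ⊓ (2 * a + d)) (count-↭ inA? r)
      (cong₂ (λ l g → Fin.toℕ b ∸ p ∸ l + g) (count-↭ (before? b) r) (count-↭ (after? b) r))

    cost-A : ∀ {x} pre → side x ≡ true → cost x pre ≡ 0
    cost-A {x} pre x∈A = cong (if_then 0 else charge x pre) (dec-true (inA? x) x∈A)

    cost-B : ∀ {x} pre → ¬ side x ≡ true → cost x pre ≡ charge x pre
    cost-B {x} pre x∉A = cong (if_then 0 else charge x pre) (dec-false (inA? x) x∉A)

    cost-↭ : ∀ x {pre pre′} → pre ↭ pre′ → cost x pre ≡ cost x pre′
    cost-↭ x r = cong (if does (inA? x) then 0 else_) (charge-↭ x r)

    potential-↭ : ∀ {pre pre′} w → pre ↭ pre′ → potential pre w ≡ potential pre′ w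
    potential-↭ []      r = refl
    potential-↭ (x ∷ w) r = cong₂ _+_ (cost-↭ x r) (potential-↭ w (prep x r))

    disorder-A : ∀ {x} b pre → side x ≡ true → disorder b pre ≡ disorder b (x ∷ pre)
    disorder-A b pre x∈A = sym (cong₂ (λ l g → (Fin.toℕ b ∸ p ∸ l) + g)
      (count-reject (before? b) (λ (x∉A , _) → x∉A x∈A))
      (count-reject (after? b) (λ (x∉A , _) → x∉A x∈A)))

    -- A letter is never both smaller and larger than `b`, so it affects only one of the two counts;
    -- this gives 1 rather than 2.
    disorder-close : ∀ b x pre → Close 1 (disorder b pre) (disorder b (x ∷ pre))
    disorder-close b x pre with b <ᶠ? x
    ... | yes b<x = close-+ {0} {1}
      (close-reflexive (cong (Fin.toℕ b ∸ p ∸_)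
        (sym (count-reject (before? b) {w = pre} (λ (_ , x<b) → <-asym x<b b<x)))))
      (count-close (after? b) x pre)
    ... | no b≮x = close-+ {1} {0}
      (close-∸ (Fin.toℕ b ∸ p) (count-close (before? b) x pre))
      (close-reflexive (sym (count-reject (after? b) {w = pre} (λ (_ , b<x) → b≮x b<x))))

    charge-close-A : ∀ b {x} pre → side x ≡ true → Close 2 (charge b pre) (charge b (x ∷ pre))
    charge-close-A b {x} pre x∈A = close-⊓
      (close-∸ (4 * p) (close-* 2 (count-close inA? x pre)))
      (close-+ {2} {0} (close-* 2 (count-close inA? x pre)) (close-reflexive (disorder-A b pre x∈A)))

    charge-close-B : ∀ b {x} pre → ¬ side x ≡ true → Close 1 (charge b pre) (charge b (x ∷ pre))
    charge-close-B b {x} pre x∉A = close-⊓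
      (close-reflexive (cong (λ c → 4 * p ∸ 2 * c) eq))
      (close-+ {0} {1} (close-reflexive (cong (2 *_) eq)) (disorder-close b x pre))
      where
      eq : count inA? pre ≡ count inA? (x ∷ pre)
      eq = sym (count-reject inA? x∉A)

    -- For each of the two letters, only the other one enters or leaves its prefix. Across sides the
    -- B-letter alone absorbs a change of 2; within B both letters absorb 1; letters of A cost
    -- nothing.
    cost-swap : ∀ x y pre → Close 2 (cost x pre + cost y (x ∷ pre)) (cost y pre + cost x (y ∷ pre))
    -- The right-hand sum is commuted so that each letter is compared with itself.
    cost-swap x y pre = subst (Close 2 _) (+-comm (cost x (y ∷ pre)) _) (by-sides (inA? x) (inA? y))
      where
      by-sides : Dec (side x ≡ true) → Dec (side y ≡ true) →
        Close 2 (cost x pre + cost y (x ∷ pre)) (cost x (y ∷ pre) + cost y pre)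
      by-sides (yes x∈A) (yes y∈A) = close-reflexive (cong₂ _+_
        (trans (cost-A pre x∈A) (sym (cost-A (y ∷ pre) x∈A))) (trans (cost-A (x ∷ pre) y∈A) (sym (cost-A pre y∈A))))
      by-sides (yes x∈A) (no y∉A) = close-+ {0} {2}
        (close-reflexive (trans (cost-A pre x∈A) (sym (cost-A (y ∷ pre) x∈A))))
        (subst₂ (Close 2) (sym (cost-B (x ∷ pre) y∉A)) (sym (cost-B pre y∉A)) (close-sym (charge-close-A y pre x∈A)))
      by-sides (no x∉A) (yes y∈A) = close-+ {2} {0}
        (subst₂ (Close 2) (sym (cost-B pre x∉A)) (sym (cost-B (y ∷ pre) x∉A)) (charge-close-A x pre y∈A))
        (close-reflexive (trans (cost-A (x ∷ pre) y∈A) (sym (cost-A pre y∈A))))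
      by-sides (no x∉A) (no y∉A) = close-+ {1} {1}
        (subst₂ (Close 1) (sym (cost-B pre x∉A)) (sym (cost-B (y ∷ pre) x∉A)) (charge-close-B x pre y∉A))
        (subst₂ (Close 1) (sym (cost-B (x ∷ pre) y∉A)) (sym (cost-B pre y∉A)) (close-sym (charge-close-B y pre x∉A)))

    potential-swap : ∀ x y pre w → Close 2 (potential pre (x ∷ y ∷ w)) (potential pre (y ∷ x ∷ w))
    potential-swap x y pre w = subst₂ (Close 2)
      (+-assoc (cost x pre) _ _) (+-assoc (cost y pre) _ _)
      (close-+ {2} {0} (cost-swap x y pre) (close-reflexive (potential-↭ w (swap y x ↭-refl))))

    mono-sides : ∀ {w} → ¬ Mixed (fromList w) →
      All (λ v → side v ≡ true) w ⊎ All (λ v → ¬ side v ≡ true) w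
    mono-sides {[]}    ¬m = inj₁ []
    mono-sides {x ∷ w} ¬m with inA? x
    ... | yes x∈A = inj₁ (All.tabulate λ v∈ → trans (sym (mono ¬m (∈-fromList⁺ {w = x ∷ w} (here refl)) (∈-fromList⁺ v∈))) x∈A)
    ... | no x∉A  = inj₂ (All.tabulate λ v∈ v∈A → x∉A (trans (mono ¬m (∈-fromList⁺ {w = x ∷ w} (here refl)) (∈-fromList⁺ v∈)) v∈A))

    potential-A : ∀ {pre w} → All (λ v → side v ≡ true) w → potential pre w ≡ 0
    potential-A []                 = refl
    potential-A {pre} (x∈A ∷ aw) = cong₂ _+_ (cost-A pre x∈A) (potential-A aw)

    -- Below all of A the first history costs 4p - 2p = 2p, and the second at least 2p. The minimum
    -- thus forgets the order within B, as it must for leaves.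
    charge-bottom : ∀ b pre → count inA? pre ≡ p → charge b pre ≡ 2 * p
    charge-bottom b pre eq = trans
      (cong (λ a → (4 * p ∸ 2 * a) ⊓ (2 * a + disorder b pre)) eq) (trans
      (cong (_⊓ (2 * p + disorder b pre)) (trans (cong (_∸ 2 * p) (arith p)) (m+n∸n≡m (2 * p) (2 * p))))
      (m≤n⇒m⊓n≡m (m≤m+n (2 * p) _)))
      where
      arith : ∀ p → 4 * p ≡ 2 * p + 2 * p
      arith = solve-∀

    potential-B : ∀ {pre w} → count inA? pre ≡ p → All (λ v → ¬ side v ≡ true) w →
      potential pre w ≡ length w * (2 * p)
    potential-B eq [] = refl
    potential-B {pre} {x ∷ w} eq (x∉A ∷ bw) = cong₂ _+_
      (trans (cost-B pre x∉A) (charge-bottom x pre eq)) (potential-B (trans (count-reject inA? x∉A) eq) bw)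

    -- If only A remains, nothing is charged. If only B remains, the counting hypothesis puts all
    -- `p` vertices of A into `pre`, and each letter is charged `2 * p` by `charge-bottom`.
    potential-mono : ∀ {pre w w′} → count inA? pre + count inA? w ≡ p → ¬ Mixed (fromList w) → w ↭ w′ →
      potential pre w ≡ potential pre w′
    potential-mono {pre} {w} {w′} eq ¬m r with mono-sides ¬m
    ... | inj₁ aw = trans (potential-A aw) (sym (potential-A (All-resp-↭ r aw)))
    ... | inj₂ bw = trans (potential-B eq′ bw)
      (trans (cong (_* (2 * p)) (↭-length r)) (sym (potential-B eq′ (All-resp-↭ r bw))))
      where
      eq′ : count inA? pre ≡ p
      eq′ = trans (sym (+-identityʳ _)) (trans (cong (λ u → count inA? pre + length u) (sym (filter-none inA? bw))) eq)

    move-count : ∀ {x pre w} → count inA? pre + count inA? (x ∷ w) ≡ p → count inA? (x ∷ pre) + count inA? w ≡ p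
    move-count {x} {pre} {w} eq = trans (count-move inA? x pre w) eq

    -- Makes the potential depend on the tree only. While the word is mixed the first letters must
    -- agree, as otherwise `foreign` yields a tube that is missing; after that only leaves are
    -- permuted. The inclusion of tubes is the form in which `kept` supplies it.
    potential-tubes : ∀ {pre w w′} → count inA? pre + count inA? w ≡ p → w ↭ w′ → Unique w →
      (∀ {X} → X ∈ₗ tubes w → X ∈ₗ tubes w′) → potential pre w ≡ potential pre w′
    potential-tubes {w = w} eq r u inc with mixed? (fromList w)
    ... | no ¬m = potential-mono eq ¬m r
    potential-tubes {w = []} eq r u inc | yes (_ , _ , u∈ , _) = contradiction u∈ ∉⊥
    potential-tubes {w = x ∷ w} {[]} eq r u inc | yes m with () ← ↭-empty-inv r
    potential-tubes {pre} {x ∷ w} {y ∷ w′} eq r u@(_ ∷ uw) inc | yes m with x ≟ᶠ y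
    ... | yes refl = cong (cost x pre +_) (potential-tubes (move-count {x} {pre} {w} eq) (drop-∷ r) uw inc′)
      where
      inc′ : ∀ {X} → X ∈ₗ tubes w → X ∈ₗ tubes w′
      inc′ X∈ with inc (there X∈)
      ... | here refl  = contradiction (x∈top x _) (∉tube w (Unique[x∷xs]⇒x∉xs u) X∈)
      ... | there X∈′  = X∈′
    ... | no x≢y with tube∋ (other∈ x≢y r)
    ...   | X , X∈ , y∈X = contradiction (inc (there X∈)) (foreign r u m X∈ y∈X)

    -- A rotation is given by its tubes alone, so its shape has to be recovered. Past the common
    -- prefix, `second` brings the words to the forms x y s and y x s′ by reordering leaves; `s` and
    -- `s′` have equal potential, and `potential-swap` does the rest.
    potential-rotate : ∀ {pre w w′} → count inA? pre + count inA? w ≡ p → w ↭ w′ → Unique w →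
      AtMostTwo (SymDiff w w′) → Close 2 (potential pre w) (potential pre w′)
    potential-rotate {w = w} eq r u two with mixed? (fromList w)
    ... | no ¬m = close-reflexive (potential-mono eq ¬m r)
    potential-rotate {w = []} eq r u two | yes (_ , _ , u∈ , _) = contradiction u∈ ∉⊥
    potential-rotate {w = x ∷ w} {[]} eq r u two | yes m with () ← ↭-empty-inv r
    potential-rotate {pre} {x ∷ w} {y ∷ w′} eq r u@(_ ∷ uw) two | yes m with x ≟ᶠ y
    ... | yes refl = close-+ {0} {2} (close-reflexive refl)
      (potential-rotate (move-count {x} {pre} {w} eq) (drop-∷ r) uw
        (λ a b c → two (SymDiff-∷ u (drop-∷ r) a) (SymDiff-∷ u (drop-∷ r) b) (SymDiff-∷ u (drop-∷ r) c)))
    ... | no x≢y with tube∋ (other∈ x≢y r) | tube∋ (other∈ (λ y≡x → x≢y (sym y≡x)) (↭-sym r))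
    ...   | X , X∈ , y∈X | X′ , X′∈ , x∈X′ = conclude
      (second x≢y r u m two sd′ x∈X′)
      (second (λ y≡x → x≢y (sym y≡x)) (↭-sym r) u′ m′
        (λ a b c → two (Sum.swap a) (Sum.swap b) (Sum.swap c)) (Sum.swap sd) y∈X)
      where
      u′ = Unique-resp-↭ r u
      m′ = subst Mixed (fromList-↭ r) m
      -- `X` is lost and `X′` is gained, which exhausts the two changes allowed.
      sd : SymDiff (x ∷ w) (y ∷ w′) X
      sd = inj₁ (there X∈ , foreign r u m X∈ y∈X)
      sd′ : SymDiff (x ∷ w) (y ∷ w′) X′
      sd′ = inj₂ (there X′∈ , foreign (↭-sym r) u′ m′ X′∈ x∈X′)
      X≢X′ : X ≢ X′
      X≢X′ X≡X′ = ∉tube w (Unique[x∷xs]⇒x∉xs u) X∈ (subst (x ∈_) (sym X≡X′) x∈X′)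
      eq′ : count inA? pre + count inA? (y ∷ w′) ≡ p
      eq′ = trans (cong (count inA? pre +_) (sym (count-↭ inA? r))) eq
      expand : ∀ {a v b s} → count inA? pre + count inA? (a ∷ v) ≡ p → v ↭ b ∷ s →
        v ≡ b ∷ s ⊎ ¬ Mixed (fromList v) → potential pre (a ∷ v) ≡ potential pre (a ∷ b ∷ s)
      expand e q (inj₁ refl) = refl
      expand {a} {v} e q (inj₂ ¬mv) = cong (cost a pre +_) (potential-mono (move-count {a} {pre} {v} e) ¬mv q)
      conclude : (∃ λ s → w ↭ y ∷ s × (w ≡ y ∷ s ⊎ ¬ Mixed (fromList w))) →
        (∃ λ s → w′ ↭ x ∷ s × (w′ ≡ x ∷ s ⊎ ¬ Mixed (fromList w′))) →
        Close 2 (potential pre (x ∷ w)) (potential pre (y ∷ w′))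
      conclude (s , q , c) (s′ , q′ , c′) = subst₂ (Close 2)
        (sym (expand eq q c))
        (trans (cong (λ z → cost y pre + (cost x (y ∷ pre) + z)) (tails c c′)) (sym (expand eq′ q′ c′)))
        (potential-swap x y pre s)
        where
        s↭s′ : s ↭ s′
        s↭s′ = drop-∷ (drop-∷ (↭-trans (swap y x ↭-refl) (↭-trans (prep x (↭-sym q)) (↭-trans r (prep y q′)))))
        eqs : count inA? (x ∷ y ∷ pre) + count inA? s ≡ p
        eqs = move-count {x} {y ∷ pre} {s} (move-count {y} {pre} {x ∷ s}
          (trans (cong (count inA? pre +_) (count-↭ inA? (swap y x ↭-refl)))
            (trans (cong (count inA? pre +_) (count-↭ inA? (prep x (↭-sym q)))) eq)))
        tails : w ≡ y ∷ s ⊎ ¬ Mixed (fromList w) → w′ ≡ x ∷ s′ ⊎ ¬ Mixed (fromList w′) →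
          potential (x ∷ y ∷ pre) s ≡ potential (x ∷ y ∷ pre) s′
        -- If either word has only leaves after its first letter, then `s` is one-sided and its
        -- order is irrelevant; otherwise the tubes of `s` and `s′` are compared.
        tails (inj₂ ¬m) _ = potential-mono eqs
          (mono-tail {y} {s} (¬m ∘ subst Mixed (sym (fromList-↭ q)))) s↭s′
        tails _ (inj₂ ¬m) = potential-mono eqs
          (mono-tail {x} {s} (¬m ∘ subst Mixed (trans (fromList-↭ (prep x s↭s′)) (sym (fromList-↭ q′))))) s↭s′
        tails (inj₁ refl) (inj₁ refl) with (x≢ ∷ y≢ ∷ us) ← u =
          potential-tubes eqs s↭s′ us kept
          where
          kept : ∀ {Z} → Z ∈ₗ tubes s → Z ∈ₗ tubes s′
          kept {Z} Z∈ with Z ∈ₗ? tubes (y ∷ x ∷ s′)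
          ... | yes (here refl) = contradiction (x∈top y _) (∉tube s (Unique[x∷xs]⇒x∉xs uw) Z∈)
          ... | yes (there (here refl)) = contradiction (x∈top x _) (∉tube (y ∷ s) (Unique[x∷xs]⇒x∉xs u) (there Z∈))
          ... | yes (there (there Z∈′)) = Z∈′
          -- `Z` contains neither `x` nor `y`, so it would be a third change beside `X′` and `X`.
          ... | no Z∉ = ⊥-elim (two (inj₁ (there (there Z∈) , Z∉)) sd sd′
            (λ { refl → ∉tube s (Unique[x∷xs]⇒x∉xs uw) Z∈ y∈X })
            (λ { refl → ∉tube (y ∷ s) (Unique[x∷xs]⇒x∉xs u) (there Z∈) x∈X′ })
            X≢X′)

-- The graph `K p q`, its two extremal words and the diameter.

module CompleteBipartite (p q : ℕ) where

  side : Fin (p + q) → Bool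
  side v = does (Fin.toℕ v <? p)

  side-A : ∀ {v} → Fin.toℕ v < p → side v ≡ true
  side-A {v} = dec-true (Fin.toℕ v <? p)

  side-B : ∀ {v} → p ≤ Fin.toℕ v → side v ≡ false
  side-B {v} = dec-false (Fin.toℕ v <? p) ∘ ≤⇒≯

  across : ∀ {u v} → Fin.toℕ u < p → p ≤ Fin.toℕ v → side u ≢ side v
  across u<p p≤v u≡v with () ← trans (sym (side-A u<p)) (trans u≡v (side-B p≤v))

  edge⇒≢ : ∀ {u v} → K p q u v → side u ≢ side v
  edge⇒≢ (inj₁ (u<p , p≤v)) = across u<p p≤v
  edge⇒≢ (inj₂ (p≤u , v<p)) = across v<p p≤u ∘ sym

  ≢⇒edge : ∀ {u v} → side u ≢ side v → K p q u v
  ≢⇒edge {u} {v} u≢v with <-≤-connex (Fin.toℕ u) p | <-≤-connex (Fin.toℕ v) p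
  ... | inj₁ u<p | inj₁ v<p = contradiction (trans (side-A u<p) (sym (side-A v<p))) u≢v
  ... | inj₁ u<p | inj₂ p≤v = inj₁ (u<p , p≤v)
  ... | inj₂ p≤u | inj₁ v<p = inj₂ (p≤u , v<p)
  ... | inj₂ p≤u | inj₂ p≤v = contradiction (trans (side-B p≤u) (sym (side-B p≤v))) u≢v

  open Bipartite side (K p q) edge⇒≢ ≢⇒edge
  open Potential p

  B⇒p≤ : ∀ {v} → ¬ side v ≡ true → p ≤ Fin.toℕ v
  B⇒p≤ v∉A = ≮⇒≥ (v∉A ∘ side-A)

  p≤⇒B : ∀ {v} → p ≤ Fin.toℕ v → ¬ side v ≡ true
  p≤⇒B p≤v v∈A with () ← trans (sym v∈A) (side-B p≤v)

  B-first : (Fin q → Fin q) → List (Fin (p + q))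
  B-first σ = tabulate (λ i → p ↑ʳ σ i) ++ tabulate (_↑ˡ q)

  ↑ˡ∈A : ∀ i → side (i ↑ˡ q) ≡ true
  ↑ˡ∈A i = side-A (subst (_< p) (sym (toℕ-↑ˡ i q)) (toℕ<n i))

  ↑ʳ∉A : ∀ i → ¬ side (p ↑ʳ i) ≡ true
  ↑ʳ∉A i = p≤⇒B (subst (p ≤_) (sym (toℕ-↑ʳ p i)) (m≤m+n p _))

  -- Both orders used, the identity and `opposite`, are involutions, which gives injectivity and
  -- surjectivity of `σ` at once.
  B-first-complete : ∀ {σ} → (∀ i → σ (σ i) ≡ i) → Complete (B-first σ)
  B-first-complete {σ} inv =
    Unique.++⁺
      (Unique.tabulate⁺ λ {i} {j} eq → trans (sym (inv i)) (trans (cong σ (↑ʳ-injective p _ _ eq)) (inv j)))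
      (Unique.tabulate⁺ (↑ˡ-injective q _ _))
      (λ (v∈B , v∈A) → let i , v≡i = ∈-tabulate⁻ v∈B ; j , v≡j = ∈-tabulate⁻ v∈A in
        ↑ʳ∉A (σ i) (trans (cong side (trans (sym v≡i) v≡j)) (↑ˡ∈A j))) ,
    λ v → subst (_∈ₗ B-first σ) (join-splitAt p q v) (member (splitAt p v))
    where
    member : ∀ s → Fin.join p q s ∈ₗ B-first σ
    member (inj₁ i) = ∈-++⁺ʳ (tabulate (λ i → p ↑ʳ σ i)) (∈-tabulate⁺ i)
    member (inj₂ j) = ∈-++⁺ˡ (subst (λ k → p ↑ʳ k ∈ₗ tabulate (λ i → p ↑ʳ σ i)) (inv j) (∈-tabulate⁺ (σ j)))

  length-As : ∀ {w} → Complete w → length (As w) ≡ p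
  length-As c = trans (count-↭ inA? (complete-↭ c (B-first-complete {λ i → i} λ _ → refl)))
    (trans (cong length (trans (filter-++ inA? bs as)
      (cong₂ _++_ (filter-none inA? (All.tabulate⁺ ↑ʳ∉A)) (filter-all inA? (All.tabulate⁺ ↑ˡ∈A)))))
      (length-tabulate {n = p} (_↑ˡ q)))
    where
    as = tabulate (_↑ˡ q)
    bs = tabulate (p ↑ʳ_)

  length-Bs : ∀ {w} → Complete w → length (Bs w) ≡ q
  length-Bs c = trans (count-↭ inB? (complete-↭ c (B-first-complete {λ i → i} λ _ → refl)))
    (trans (cong length (trans (filter-++ inB? bs as)
      (trans (cong₂ _++_ (filter-all inB? (All.tabulate⁺ ↑ʳ∉A)) (filter-none inB? (All.tabulate⁺ λ i i∉A → i∉A (↑ˡ∈A i))))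
        (++-identityʳ bs))))
      (length-tabulate {n = q} (p ↑ʳ_)))
    where
    as = tabulate (_↑ˡ q)
    bs = tabulate (p ↑ʳ_)

  -- Above each B-vertex lie exactly the smaller ones and nothing of A, so its second history is
  -- free. The function `f` lists the part of B still to come, which starts at rank `length pre`.
  potential-ascending : ∀ {m} (f : Fin m → Fin (p + q)) {pre rest} →
    (∀ i → Fin.toℕ (f i) ≡ p + (length pre + Fin.toℕ i)) →
    All (λ v → ¬ side v ≡ true × Fin.toℕ v < p + length pre) pre →
    All (λ v → side v ≡ true) rest →
    potential pre (tabulate f ++ rest) ≡ 0
  potential-ascending {zero}  f _ _ rest∈A = potential-A rest∈A
  potential-ascending {suc m} f {pre} f≡ pre< rest∈A = cong₂ _+_
    (trans (cost-B pre b∉A) (trans (cong ((4 * p ∸ 2 * count inA? pre) ⊓_) no-charge) (⊓-zeroʳ _)))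
    (potential-ascending (f ∘ Fin.suc)
      (λ i → trans (f≡ (Fin.suc i)) (cong (p +_) (+-suc (length pre) _)))
      ((b∉A , subst (_< p + suc (length pre)) (sym b≡) (+-monoʳ-< p (n<1+n _))) ∷
        All.map (λ (v∉A , v<) → v∉A , <-trans v< (+-monoʳ-< p (n<1+n _))) pre<)
      rest∈A)
    where
    b = f Fin.zero
    b≡ : Fin.toℕ b ≡ p + length pre
    b≡ = trans (f≡ Fin.zero) (cong (p +_) (+-identityʳ _))
    b∉A : ¬ side b ≡ true
    b∉A = p≤⇒B (subst (p ≤_) (sym b≡) (m≤m+n p _))
    no-charge : 2 * count inA? pre + disorder b pre ≡ 0
    no-charge = cong₂ (λ a d → 2 * a + d)
      (cong length (filter-none inA? (All.map proj₁ pre<)))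
      (cong₂ _+_
        (trans (cong₂ (λ i l → i ∸ p ∸ l) b≡ (cong length (filter-all (before? b)
            (All.map (λ (v∉A , v<) → v∉A , subst (_ <_) (sym b≡) v<) pre<))))
          (trans (cong (_∸ length pre) (m+n∸m≡n p (length pre))) (n∸n≡0 (length pre))))
        (cong length (filter-none (after? b)
          (All.map (λ (_ , v<) (_ , b<v) → <-asym b<v (subst (_ <_) (sym b≡) v<)) pre<))))

  -- Each B-vertex has nothing of A above it and is out of order with all q - 1 others, so its
  -- charge is the minimum of 4p and q - 1. This is where the bound on `q` enters.
  potential-descending : 4 * p + 1 ≤ q → ∀ {m} (f : Fin m → Fin (p + q)) {pre rest} →
    (∀ i → ¬ side (f i) ≡ true) →
    (∀ i → Fin.toℕ (f i) + suc (length pre + Fin.toℕ i) ≡ p + q) →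
    All (λ v → ¬ side v ≡ true × p + q ≤ Fin.toℕ v + length pre) pre →
    All (λ v → side v ≡ true) rest →
    potential pre (tabulate f ++ rest) ≡ m * (4 * p)
  potential-descending _ {zero} f _ _ _ rest∈A = potential-A rest∈A
  potential-descending 4p<q {suc m} f {pre} f∉A f≡ pre≥ rest∈A = cong₂ _+_
    (trans (cost-B pre (f∉A Fin.zero)) full-charge)
    (potential-descending 4p<q (f ∘ Fin.suc) (f∉A ∘ Fin.suc)
      (λ i → trans (cong (λ k → Fin.toℕ (f (Fin.suc i)) + suc k) (sym (+-suc (length pre) _))) (f≡ (Fin.suc i)))
      ((f∉A Fin.zero , ≤-reflexive (sym b≡)) ∷
        All.map (λ {v} (v∉A , v≥) → v∉A , ≤-trans v≥ (+-monoʳ-≤ (Fin.toℕ v) (n≤1+n _))) pre≥)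
      rest∈A)
    where
    b = f Fin.zero
    j = Fin.toℕ b ∸ p
    b≡ : Fin.toℕ b + suc (length pre) ≡ p + q
    b≡ = trans (cong (λ k → Fin.toℕ b + suc k) (sym (+-identityʳ _))) (f≡ Fin.zero)
    b<pre : All (λ v → ¬ side v ≡ true × b <ᶠ v) pre
    b<pre = All.map (λ {v} (v∉A , v≥) → v∉A , +-cancelʳ-< (length pre) _ _
      (≤-trans (≤-reflexive (trans (sym (+-suc (Fin.toℕ b) (length pre))) b≡)) v≥)) pre≥
    -- The `j` smaller vertices and the `length pre` larger ones make up B without `b` itself, which
    -- accounts for the 1.
    j≡ : j + length pre + 1 ≡ q
    j≡ = +-cancelˡ-≡ p _ _ (trans (arith p j (length pre))
      (trans (cong (_+ suc (length pre)) (m+[n∸m]≡n (B⇒p≤ (f∉A Fin.zero)))) b≡))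
      where
      arith : ∀ p j l → p + (j + l + 1) ≡ (p + j) + suc l
      arith = solve-∀
    counts : charge b pre ≡ (4 * p) ⊓ (j + length pre)
    counts = trans
      (cong₂ (λ a d → (4 * p ∸ 2 * a) ⊓ (2 * a + d)) (cong length (filter-none inA? (All.map proj₁ pre≥)))
        (cong₂ (λ l g → (j ∸ l) + g)
          (cong length (filter-none (before? b) (All.map (λ (_ , b<v) (_ , v<b) → <-asym v<b b<v) b<pre)))
          (cong length (filter-all (after? b) b<pre))))
      refl
    full-charge : charge b pre ≡ 4 * p
    full-charge = trans counts (m≤n⇒m⊓n≡m (+-cancelʳ-≤ 1 _ _ (≤-trans 4p<q (≤-reflexive (sym j≡)))))

  -- Each rotation raises the potential by at most 2. The words of intermediate trees are arbitrary
  -- choices of `completeWord`; at the end two words with the same tubes are compared by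
  -- `potential-tubes`.
  walk-bound : ∀ {s t k w w′} → Mixed ⊤ → Complete w → Complete w′ → Represents s w → Represents t w′ →
    Walk (K p q) s t k → potential [] w′ ≤ 2 * k + potential [] w
  walk-bound _ c c′ r r′ (stop e) = ≤-reflexive (sym (potential-tubes (length-As c) (complete-↭ c c′) (proj₁ c)
    (λ {X} X∈ → to (r′ X) (to (e X) (from (r X) X∈)))))
  walk-bound {w = w} m c c′ r r′ (move {k = k} rot st walk) with completeWord m st
  ... | w₁ , c₁ , r₁ = ≤-trans (walk-bound m c₁ c′ r₁ r′ walk)
    (≤-trans (+-monoʳ-≤ (2 * k) (Close.above (potential-rotate (length-As c) (complete-↭ c c₁) (proj₁ c)
        (Rotates⇒AtMostTwo (Rotation⇒Rotates r r₁ rot)))))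
      (≤-reflexive (arith k (potential [] w))))
    where
    arith : ∀ k a → 2 * k + (2 + a) ≡ 2 * suc k + a
    arith = solve-∀

  diameter : 0 < p → 0 < q → 4 * p + 1 ≤ q → Diameter≡ (K p q) (2 * p * q)
  diameter 0<p 0<q 4p<q = upper , lower
    where
    mixed : Mixed ⊤
    mixed = fromℕ< 0<p ↑ˡ q , p ↑ʳ fromℕ< 0<q , ∈⊤ , ∈⊤ , A≢B (↑ˡ∈A _) (↑ʳ∉A _)

    upper : ∀ s t → SearchTree (K p q) s → SearchTree (K p q) t → ∃ λ k → k ≤ 2 * p * q × Walk (K p q) s t k
    upper s t ss st with completeWord mixed ss | completeWord mixed st
    ... | w , c , r | w′ , c′ , r′ with path≤ (complete-↭ c c′)
    ...   | k , k≤ , path = k ,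
      subst (k ≤_) (trans (cong (2 *_) (cong₂ _*_ (length-As c) (length-Bs c))) (sym (*-assoc 2 p q))) k≤ ,
      realise mixed c r r′ path

    ascending : Complete (B-first (λ i → i))
    ascending = B-first-complete λ _ → refl

    descending : Complete (B-first opposite)
    descending = B-first-complete opposite-involutive

    toℕ-opposite : ∀ i → Fin.toℕ (p ↑ʳ opposite i) + suc (Fin.toℕ i) ≡ p + q
    toℕ-opposite i = trans (cong (_+ suc (Fin.toℕ i)) (trans (toℕ-↑ʳ p (opposite i)) (cong (p +_) (opposite-prop i))))
      (trans (+-assoc p _ _) (cong (p +_) (m∸n+n≡m (toℕ<n i))))

    lower : ∃ λ s → ∃ λ t → SearchTree (K p q) s × SearchTree (K p q) t × (∀ k → Walk (K p q) s t k → 2 * p * q ≤ k)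
    lower with completeTree mixed ascending | completeTree mixed descending
    -- The potential rises from 0 to 4p for each of the q vertices of B, at most 2 per rotation; the
    -- common factor 2 is cancelled last.
    ... | s , ss , r | t , st , r′ = s , t , ss , st , λ k walk → *-cancelˡ-≤ 2 (begin
      2 * (2 * p * q)                    ≡⟨ arith p q ⟩
      q * (4 * p)                        ≡⟨ potential-descending 4p<q _ (↑ʳ∉A ∘ opposite) toℕ-opposite [] (All.tabulate⁺ ↑ˡ∈A) ⟨
      potential [] (B-first opposite)    ≤⟨ walk-bound mixed ascending descending r r′ walk ⟩
      2 * k + potential [] (B-first (λ i → i)) ≡⟨ cong (2 * k +_) (potential-ascending (p ↑ʳ_) (toℕ-↑ʳ p) [] (All.tabulate⁺ ↑ˡ∈A)) ⟩
      2 * k + 0                          ≡⟨ +-identityʳ (2 * k) ⟩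
      2 * k                              ∎)
      where
      open ≤-Reasoning
      arith : ∀ p q → 2 * (2 * p * q) ≡ q * (4 * p)
      arith = solve-∀

theorem9 : (p q : ℕ) → 0 < p → 0 < q → 4 * p + 1 ≤ q →
    Diameter≡ (K p q) (2 * p * q)
theorem9 = CompleteBipartite.diameter
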